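{- Let $k \in \mathbb{N}$, and let $\lambda$ be a finite pointed poset of degree $\ell$ and height $n$. Then the Strategy (described in the context), applied to $\lambda$ with limit $k$, guarantees identification of the hidden ideal $\mu$ of $\lambda$ (for every ideal $\mu$ of $\lambda$), using at most $k$ positive queries and at most $$f_{k,\ell}(n) := \sum_{i=0}^{\lceil n/k \rceil-1} \ell^i + \sum_{j=1}^{k-1} \ell^{\lceil (n-j)/k\rceil}$$ total queries. Moreover, $$f_{k,\ell}(n) \leq \begin{cases} \left\lceil \frac{n}{k}\right\rceil + k - 1 & \text{if } \ell = 1;\\ k\,\ell^{\lceil n/k \rceil} & \text{if } \ell > 1.\end{cases}$$
   Context: $\mathbb{N}=\mathbb{Z}_{>0}$ and $0^0=1$. All posets are finite. A poset $\lambda$ (with order $\succcurlyeq$) is pointed if for all $a,b\in\lambda$ there is $c\in\lambda$ with $a\succcurlyeq c$ and $b\succcurlyeq c$; equivalently (for finite posets), $\lambda=\varnothing$ or $\lambda$ has a unique minimal element. For $v\in\lambda$: $\lambda_{\succcurlyeq v}=\{u\in\lambda\mid u\succcurlyeq v\}$, $\lambda_{\preccurlyeq v}=\{u\in\lambda\mid u\preccurlyeq v\}$, $\lambda_{\not\succcurlyeq v}=\{u\in\lambda\mid u\not\succcurlyeq v\}$, each with the inherited order. An ideal of $\lambda$ is a subset equal to $\varnothing$ or to $\lambda_{\preccurlyeq v}$ for some $v\in\lambda$. The degree of $v\in \lambda$ is the number of elements of $\lambda$ covering $v$; the degree of $\lambda$ is the maximum of the degrees of its elements ($0$ if $\lambda=\varnothing$).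 A maximal $\lambda$-chain (or "maximal chain in $\lambda$") means a chain in $\lambda$ of maximum cardinality. The height $\mathrm{ht}(\lambda)$ is the cardinality of a maximal $\lambda$-chain, and the height $\mathrm{ht}(v)$ of $v\in\lambda$ is the maximum cardinality of a chain in $\lambda$ with top element $v$ (so the minimal element of a pointed poset has height $1$). Hidden ideal problem: the poset $\lambda^0$ is known, $\mu$ is an unknown ideal of $\lambda^0$. One may sequentially (adaptively) query elements $v\in\lambda^0$, learning whether $v\in\mu$ (a positive query) or $v\notin\mu$ (a negative query). At most a given number $k^0\in \mathbb{N}$ of positive query results is permitted. The goal is to identify $\mu$. The Strategy, for input $(\lambda^0,k^0)$ with $\lambda^0$ pointed: set $\lambda:=\lambda^0$, $k:=k^0$ and repeat the following round on the current pair $(\lambda,k)$; all heights and maximal chains below are computed in the current $\lambda$. (1) If $\lambda=\varnothing$, terminate with answer $\mu=\varnothing$. (2) If $\lambda=\{v\}$, query $v$; terminate with answer $\mu=\lambda^0_{\preccurlyeq v}$ if $v\in\mu$, and $\mu=\varnothing$ if $v\notin\mu$. (3) If $|\lambda|>1$, set $n:=\mathrm{ht}(\lambda)$ and choose a node $v$ as follows: if $k=1$, $v$ is any node of height $n$; if $k\geq n$, $v$ is any node of height $2$ belonging to a maximal chain in $\lambda$; if $1<k<n$, $v$ is any node of height $\lceil\frac{n+1}{k}\rceil$ belonging to a maximal chain in $\lambda$. Query $v$. If $v\in\mu$, replace $\lambda$ by $\lambda_{\succcurlyeq v}$ and $k$ by $k-1$; then, if the new $\lambda$ has exactly one element, terminate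 with answer $\mu=\lambda^0_{\preccurlyeq v}$, and otherwise start a new round. If $v\notin\mu$, replace $\lambda$ by $\lambda_{\not\succcurlyeq v}$, keep $k$, and start a new round. The guarantees are for every admissible sequence of choices of the nodes $v$. -}

module Defs where

open import Data.Empty using () renaming (⊥ to Absurd)
open import Data.Fin using (Fin)
open import Data.Fin.Properties using (any?)
open import Data.Fin.Subset using (Subset; ⊥; ⊤; ⁅_⁆; _∈_; _∉_; _⊆_; _∩_; ∣_∣)
open import Data.List using (map; upTo; applyUpTo; allFin)
open import Data.List.Extrema.Nat using (max)
open import Data.Nat using (ℕ; suc; pred; _+_; _∸_; _^_; _/_; _≤_; _<_; NonZero)
open import Data.Nat.ListAction using (sum)
open import Data.Product using (∃-syntax; _×_)
open import Data.Sum using (_⊎_)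
open import Data.Vec using (tabulate)
open import Function using (flip)
open import Induction.WellFounded using (Acc)
open import Level using (0ℓ)
open import Relation.Binary using (Rel; IsDecPartialOrder)
import Relation.Binary.Construct.NonStrictToStrict as NonStrictToStrict
open import Relation.Binary.Construct.Closure.ReflexiveTransitive using (Star)
open import Relation.Binary.PropositionalEquality using (_≡_; _≢_)
open import Relation.Binary.Rewriting using (IsNormalForm)
open import Relation.Nullary using (¬_; Dec; does; ¬?)
open import Relation.Nullary.Decidable using (_×-dec_)
open import Relation.Unary using (Pred; Decidable)

⌈_/_⌉ : (m k : ℕ) .{{_ : NonZero k}} → ℕ
⌈ m / k ⌉ = (m + pred k) / k

-- The truncated n ∸ j is harmless: if n < j < k then −1 < (n − j)/k < 0, whose
-- ceiling is 0 = ⌈ 0 / k ⌉.  Also 0 ^ 0 reduces to 1.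
f : (k ℓ n : ℕ) .{{_ : NonZero k}} → ℕ
f k ℓ n = sum (map (λ i → ℓ ^ i) (upTo ⌈ n / k ⌉))
        + sum (map (λ j → ℓ ^ ⌈ n ∸ j / k ⌉) (applyUpTo suc (k ∸ 1)))

⟦_⟧ : ∀ {N} {P : Pred (Fin N) 0ℓ} → Decidable P → Subset N
⟦ P? ⟧ = tabulate (λ v → does (P? v))

-- Every finite poset is isomorphic to one of these.
record FinPoset : Set₁ where
  infix 4 _≼_
  field
    size              : ℕ
    _≼_               : Rel (Fin size) 0ℓ
    isDecPartialOrder : IsDecPartialOrder _≡_ _≼_

  open IsDecPartialOrder isDecPartialOrder public
    using () renaming (_≤?_ to _≼?_; _≟_ to _≟ₚ_)

  open NonStrictToStrict _≡_ _≼_ public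
    using () renaming (_<_ to _≺_; <-decidable to ≺-decidable)

  Node : Set
  Node = Fin size

  -- The posets met while running the strategy are subsets Λ of the original
  -- one with the inherited order.
  Nodes : Set
  Nodes = Subset size

  Pointed : Set
  Pointed = ∀ a b → ∃[ c ] c ≼ a × c ≼ b

  _Covers_ : Rel Node 0ℓ
  u Covers v = v ≺ u × ¬ (∃[ w ] v ≺ w × w ≺ u)

  _covers?_ : ∀ u v → Dec (u Covers v)
  u covers? v = (v ≺? u) ×-dec ¬? (any? λ w → (v ≺? w) ×-dec (w ≺? u))
    where _≺?_ = ≺-decidable _≟ₚ_ _≼?_

  nodeDegree : Node → ℕ
  nodeDegree v = ∣ ⟦ (λ u → u covers? v) ⟧ ∣

  degree : ℕ
  degree = max 0 (map nodeDegree (allFin size))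

  ↓_ : Node → Nodes
  ↓ v = ⟦ (λ u → u ≼? v) ⟧

  IsIdeal : Nodes → Set
  IsIdeal μ = μ ≡ ⊥ ⊎ (∃[ v ] μ ≡ ↓ v)

  _≽[_] : Nodes → Node → Nodes
  Λ ≽[ v ] = Λ ∩ ⟦ (λ u → v ≼? u) ⟧

  _⋡[_] : Nodes → Node → Nodes
  Λ ⋡[ v ] = Λ ∩ ⟦ (λ u → ¬? (v ≼? u)) ⟧

  IsChain : Nodes → Set
  IsChain C = ∀ {u v} → u ∈ C → v ∈ C → u ≼ v ⊎ v ≼ u

  ChainIn : Nodes → Nodes → Set
  ChainIn Λ C = C ⊆ Λ × IsChain C

  -- "Maximal" refers to cardinality, not to inclusion.
  MaximalChain : Nodes → Nodes → Set
  MaximalChain Λ C = ChainIn Λ C × (∀ D → ChainIn Λ D → ∣ D ∣ ≤ ∣ C ∣)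

  HasHeight : Nodes → ℕ → Set
  HasHeight Λ n = ∃[ C ] MaximalChain Λ C × ∣ C ∣ ≡ n

  ChainWithTop : Nodes → Node → Nodes → Set
  ChainWithTop Λ v C = ChainIn Λ C × v ∈ C × (∀ {u} → u ∈ C → u ≼ v)

  HasNodeHeight : Nodes → Node → ℕ → Set
  HasNodeHeight Λ v h =
    ∃[ C ] ChainWithTop Λ v C × (∀ D → ChainWithTop Λ v D → ∣ D ∣ ≤ ∣ C ∣) × ∣ C ∣ ≡ h

  OnMaximalChain : Nodes → Node → Set
  OnMaximalChain Λ v = ∃[ C ] MaximalChain Λ C × v ∈ C

  -- The nodes v that may be queried when ∣ Λ ∣ > 1; μ does not occur here, so
  -- the choice depends on μ only through the results of earlier queries.
  data Admissible (Λ : Nodes) : ℕ → Node → Set where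
    k≡1   : ∀ {n v} → HasHeight Λ n →
            HasNodeHeight Λ v n →
            Admissible Λ 1 v
    k≥n   : ∀ {k n v} → HasHeight Λ n → n ≤ k →
            OnMaximalChain Λ v → HasNodeHeight Λ v 2 →
            Admissible Λ k v
    1<k<n : ∀ {k n v} .{{_ : NonZero k}} → HasHeight Λ n → 1 < k → k < n →
            OnMaximalChain Λ v → HasNodeHeight Λ v ⌈ n + 1 / k ⌉ →
            Admissible Λ k v

  -- p and q count the positive queries and all queries made so far.
  data State : Set where
    running : (Λ : Nodes) (k p q : ℕ) → State
    done    : (answer : Nodes) (p q : ℕ) → State

  positives queries : State → ℕ
  positives (running _ _ p _) = p
  positives (done _ p _)      = p
  queries (running _ _ _ q) = q
  queries (done _ _ q)      = q

  start : ℕ → State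
  start k = running ⊤ k 0 0

  data Round (μ : Nodes) : Rel State 0ℓ where
    empty         : ∀ {Λ k p q} → Λ ≡ ⊥ →
                    Round μ (running Λ k p q) (done ⊥ p q)
    singleton-yes : ∀ {Λ k p q v} → Λ ≡ ⁅ v ⁆ → v ∈ μ →
                    Round μ (running Λ k p q) (done (↓ v) (suc p) (suc q))
    singleton-no  : ∀ {Λ k p q v} → Λ ≡ ⁅ v ⁆ → v ∉ μ →
                    Round μ (running Λ k p q) (done ⊥ p (suc q))
    yes-stop      : ∀ {Λ k p q v} → 1 < ∣ Λ ∣ → Admissible Λ k v → v ∈ μ →
                    ∣ Λ ≽[ v ] ∣ ≡ 1 →
                    Round μ (running Λ k p q) (done (↓ v) (suc p) (suc q))
    yes-continue  : ∀ {Λ k p q v} → 1 < ∣ Λ ∣ → Admissible Λ k v → v ∈ μ →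
                    ∣ Λ ≽[ v ] ∣ ≢ 1 →
                    Round μ (running Λ k p q)
                            (running (Λ ≽[ v ]) (k ∸ 1) (suc p) (suc q))
    no-continue   : ∀ {Λ k p q v} → 1 < ∣ Λ ∣ → Admissible Λ k v → v ∉ μ →
                    Round μ (running Λ k p q)
                            (running (Λ ⋡[ v ]) k p (suc q))

  Reachable : (μ : Nodes) (k : ℕ) → State → Set
  Reachable μ k = Star (Round μ) (start k)

  Answers : State → Nodes → Set
  Answers (running _ _ _ _) μ = Absurd
  Answers (done answer _ _) μ = answer ≡ μ

  -- Every run is finite, and wherever it can go no further it has answered μ;
  -- in particular the strategy never gets stuck in a running state for want of
  -- an admissible node.
  Identifies : (μ : Nodes) (k : ℕ) → Set
  Identifies μ k = Acc (flip (Round μ)) (start k)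
                 × (∀ {s} → Reachable μ k s → IsNormalForm (Round μ) s → Answers s μ)

{-# OPTIONS --safe #-}

-- Climbing by covers from the base of a pointed poset, one reaches at most ℓ ^ i
-- nodes at level i, and a chain of maximum cardinality meets every level below
-- its length.  Let k ≥ 2 and q = max(1, ⌊n/k⌋), so that the strategy queries
-- nodes v of height at most q + 1 lying on a chain of maximum cardinality.  As
-- long as the height exceeds q there is a node at level q above v, which a
-- negative answer removes: this happens at most ℓ ^ q times.  A positive answer
-- leaves k - 1 and height at most n - q, and f k ℓ n ≥ ℓ ^ q + f (k - 1) ℓ (n - q).
-- If the height drops to q before any positive answer, induction on n applies,
-- because f k ℓ q ≤ f (k - 1) ℓ (n - q) when q ≥ 2, while a single node costs one
-- query.  For k = 1 every query removes a node from the levels below n.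

module Submission where

open import Defs
open import Data.Empty using () renaming (⊥ to Absurd)
open import Data.Fin as Fin using (Fin)
open import Data.Fin.Properties using (any?)
open import Data.Fin.Subset
  using (Subset; inside; outside; ⊤; ⁅_⁆; _∈_; _∉_; _⊆_; _∩_; _∪_; _-_; ∣_∣; Nonempty)
  renaming (⊥ to ∅)
open import Data.Fin.Subset.Properties
open import Data.List
  using (List; []; _∷_; length; filter; allFin; concatMap; map; upTo; applyUpTo)
import Data.List as List
open import Data.List.Extrema.Nat using (xs≤max)
open import Data.List.Membership.Propositional using (lose) renaming (_∈_ to _∈ˡ_)
open import Data.List.Membership.Propositional.Properties
  using (∈-filter⁺; ∈-allFin; ∈-concatMap⁺; ∈-map⁺; ∈-upTo⁺)
open import Data.List.Properties using (length-++; filter-notAll)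
open import Data.List.Relation.Unary.All as All using (All; []; _∷_)
open import Data.List.Relation.Unary.Any as Any using (here; there)
open import Data.Nat hiding (∣_-_∣)
open import Data.Nat.Divisibility using (n∣m*n)
open import Data.Nat.DivMod
open import Data.Nat.Induction using (<-wellFounded)
open import Data.Nat.ListAction using (sum)
open import Data.Nat.Properties
open import Data.Nat.Tactic.RingSolver using (solve-∀)
open import Data.Product using (_×_; _,_; ∃-syntax; proj₁; proj₂)
open import Data.Sum using (_⊎_; inj₁; inj₂; swap)
open import Data.Vec using ([]; _∷_; tabulate)
open import Data.Vec.Properties using (lookup∘tabulate; lookup⇒[]=; []=⇒lookup)
open import Function using (id; _∘_; flip)
open import Induction.WellFounded using (Acc; acc)
open import Level using (0ℓ)
open import Relation.Binary using (IsDecPartialOrder)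
open import Relation.Binary.Construct.Closure.ReflexiveTransitive using (Star; ε; _◅_)
open import Relation.Binary.PropositionalEquality
  using (_≡_; _≢_; refl; cong; sym; trans; subst; module ≡-Reasoning)
open import Relation.Binary.Rewriting using (IsNormalForm)
open import Relation.Nullary using (¬_; yes; no; contradiction; does; ¬?)
open import Relation.Nullary.Decidable using (_×-dec_; dec-true; decidable-stable)
open import Relation.Unary using (Pred; Decidable)

private
  variable
    a d e j m n o : ℕ

-- Ceilings and the function f

sumUpTo-mono-≤ : ∀ {g g′ s s′ : ℕ → ℕ} m → (∀ {i} → i < m → g (s i) ≤ g′ (s′ i)) →
                 sum (map g (applyUpTo s m)) ≤ sum (map g′ (applyUpTo s′ m))
sumUpTo-mono-≤ zero    g≤g′ = z≤n
sumUpTo-mono-≤ (suc m) g≤g′ = +-mono-≤ (g≤g′ z<s) (sumUpTo-mono-≤ m (g≤g′ ∘ s<s))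

sumUpTo-monoʳ-≤ : ∀ (g s : ℕ → ℕ) → m ≤ n →
                  sum (map g (applyUpTo s m)) ≤ sum (map g (applyUpTo s n))
sumUpTo-monoʳ-≤ g s z≤n       = z≤n
sumUpTo-monoʳ-≤ g s (s≤s m≤n) = +-monoʳ-≤ (g (s 0)) (sumUpTo-monoʳ-≤ g (s ∘ suc) m≤n)

sumUpTo-suc : ∀ (g s : ℕ → ℕ) m →
              sum (map g (applyUpTo s (suc m))) ≡ sum (map g (applyUpTo s m)) + g (s m)
sumUpTo-suc g s zero    = +-identityʳ (g (s 0))
sumUpTo-suc g s (suc m) =
  trans (cong (g (s 0) +_) (sumUpTo-suc g (s ∘ suc) m))
        (sym (+-assoc (g (s 0)) _ _))

sumUpTo-≤-* : ∀ (g s : ℕ → ℕ) m → (∀ {i} → i < m → g (s i) ≤ o) →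
              sum (map g (applyUpTo s m)) ≤ m * o
sumUpTo-≤-* g s zero    g≤c = z≤n
sumUpTo-≤-* g s (suc m) g≤c = +-mono-≤ (g≤c z<s) (sumUpTo-≤-* g (s ∘ suc) m (g≤c ∘ s<s))

-- Together with `≤⌈/⌉*` this makes the ceiling the least multiplier o with a ≤ o * suc e; most
-- comparisons of ceilings below go through that property instead of through division.
⌈/⌉-least : ∀ a e → a ≤ o * suc e → ⌈ a / suc e ⌉ ≤ o
⌈/⌉-least {o} a e a≤cd = s≤s⁻¹ (m<n*o⇒m/o<n {n = suc o} (begin-strict
  a + e               ≤⟨ +-monoˡ-≤ e a≤cd ⟩
  o * suc e + e       ≡⟨ +-comm (o * suc e) e ⟩
  e + o * suc e       <⟨ ≤-refl ⟩
  suc e + o * suc e   ∎))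
  where open ≤-Reasoning

≤⌈/⌉* : ∀ a e → a ≤ ⌈ a / suc e ⌉ * suc e
≤⌈/⌉* a e = +-cancelʳ-≤ e a _ (begin
  a + e                                          ≡⟨ m≡m%n+[m/n]*n (a + e) (suc e) ⟩
  (a + e) % suc e + ⌈ a / suc e ⌉ * suc e       ≤⟨ +-monoˡ-≤ _ (s≤s⁻¹ (m%n<n (a + e) (suc e))) ⟩
  e + ⌈ a / suc e ⌉ * suc e                      ≡⟨ +-comm e _ ⟩
  ⌈ a / suc e ⌉ * suc e + e                      ∎)
  where open ≤-Reasoning

⌈/⌉-greatest : ∀ a e → o * suc e ≤ a + e → o ≤ ⌈ a / suc e ⌉
⌈/⌉-greatest {o} a e p =
  subst (_≤ ⌈ a / suc e ⌉) (m*n/n≡m o (suc e)) (/-monoˡ-≤ (suc e) p)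

⌈/⌉≤1 : ∀ a e → a ≤ suc e → ⌈ a / suc e ⌉ ≤ 1
⌈/⌉≤1 a e a≤ = ⌈/⌉-least a e (≤-trans a≤ (≤-reflexive (sym (+-identityʳ (suc e)))))

1≤⌈/⌉ : ∀ a e → 1 ≤ a → 1 ≤ ⌈ a / suc e ⌉
1≤⌈/⌉ a e 1≤a = ⌈/⌉-greatest a e (≤-trans (≤-reflexive (+-identityʳ (suc e))) (+-monoˡ-≤ e 1≤a))

⌈/⌉-monoˡ-≤ : ∀ e → m ≤ n → ⌈ m / suc e ⌉ ≤ ⌈ n / suc e ⌉
⌈/⌉-monoˡ-≤ e m≤n = /-monoˡ-≤ (suc e) (+-monoˡ-≤ e m≤n)

⌈/⌉-mono-≤ : m ≤ n → e ≤ d → ⌈ m / suc d ⌉ ≤ ⌈ n / suc e ⌉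
⌈/⌉-mono-≤ {m} {n} {e} {d} m≤n e≤d = ⌈/⌉-least m d (begin
  m                         ≤⟨ m≤n ⟩
  n                         ≤⟨ ≤⌈/⌉* n e ⟩
  ⌈ n / suc e ⌉ * suc e     ≤⟨ *-monoʳ-≤ ⌈ n / suc e ⌉ (s≤s e≤d) ⟩
  ⌈ n / suc e ⌉ * suc d     ∎)
  where open ≤-Reasoning

-- This puts the query height prescribed for 1 < k < n into floor form: adding k to the numerator
-- adds 1 to the quotient.
⌈1+n/k⌉≡1+n/k : ∀ n e → ⌈ n + 1 / suc e ⌉ ≡ suc (n / suc e)
⌈1+n/k⌉≡1+n/k n e = begin
  (n + 1 + e) / suc e       ≡⟨ /-congˡ {o = suc e} (+-assoc n 1 e) ⟩
  (n + suc e) / suc e       ≡⟨ m/n≡1+[m∸n]/n (m≤n+m (suc e) n) ⟩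
  suc ((n + suc e ∸ suc e) / suc e) ≡⟨ cong suc (/-congˡ {o = suc e} (m+n∸n≡m n (suc e))) ⟩
  suc (n / suc e)           ∎
  where open ≡-Reasoning

-- Equivalently, m - ⌊m/k⌋ does not decrease as m grows; this compares the height left by a positive
-- answer in a poset of height m ≤ n with that for height n.
/-lipschitz : ∀ n m e → (m + n) / suc e ≤ m / suc e + n
/-lipschitz n m e = begin
  (m + n) / suc e                    ≤⟨ /-monoˡ-≤ (suc e) (+-monoʳ-≤ m (m≤m*n n (suc e))) ⟩
  (m + n * suc e) / suc e            ≡⟨ +-distrib-/-∣ʳ m (n∣m*n n) ⟩
  m / suc e + n * suc e / suc e      ≡⟨ cong (m / suc e +_) (m*n/n≡m n (suc e)) ⟩
  m / suc e + n                      ∎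
  where open ≤-Reasoning

-- Splitting one summand off `f`

module _ {ℓ : ℕ} {{_ : NonZero ℓ}} where

  -- For k > n the exponents are n - 1 ones followed by zeros.
  f-split-< : ∀ e → 2 ≤ n → n < 2 + e → ℓ ^ 1 + f (suc e) ℓ (n ∸ 1) ≤ f (2 + e) ℓ n
  f-split-< {suc n} e (s≤s 1≤n) n<k = begin
    ℓ ^ 1 + (A′ + B′)                    ≡⟨ rearrange (ℓ ^ 1) A′ B′ ⟩
    -- The summand j = 1 absorbs ℓ ^ 1; the summand j + 1 for `suc n` is matched with the summand j
    -- for `n`.
    A′ + (ℓ ^ 1 + B′)                    ≤⟨ +-mono-≤ A′≤A (+-mono-≤ ℓ¹≤ B′≤B) ⟩
    A + (ℓ ^ ⌈ n / 2 + e ⌉ + B)          ∎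
    where
    open ≤-Reasoning
    A′ = sum (map (ℓ ^_) (upTo ⌈ n / suc e ⌉))
    B′ = sum (map (λ j → ℓ ^ ⌈ n ∸ j / suc e ⌉) (applyUpTo suc e))
    A = sum (map (ℓ ^_) (upTo ⌈ suc n / 2 + e ⌉))
    B = sum (map (λ j → ℓ ^ ⌈ suc n ∸ j / 2 + e ⌉) (applyUpTo (suc ∘ suc) e))
    rearrange : ∀ x y z → x + (y + z) ≡ y + (x + z)
    rearrange = solve-∀
    n≤k-1 : n ≤ suc e
    n≤k-1 = ≤-trans (s≤s⁻¹ (s≤s⁻¹ n<k)) (n≤1+n e)
    A′≤A : A′ ≤ A
    A′≤A = sumUpTo-monoʳ-≤ (ℓ ^_) id
      (≤-trans (⌈/⌉≤1 n e n≤k-1) (1≤⌈/⌉ (suc n) (suc e) z<s))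
    ℓ¹≤ : ℓ ^ 1 ≤ ℓ ^ ⌈ n / 2 + e ⌉
    ℓ¹≤ = ^-monoʳ-≤ ℓ (1≤⌈/⌉ n (suc e) 1≤n)
    ⌈/⌉≤ : ∀ a → a ≤ n → ⌈ a / suc e ⌉ ≤ ⌈ a / 2 + e ⌉
    ⌈/⌉≤ zero    _   = ⌈/⌉-least 0 e z≤n
    ⌈/⌉≤ (suc a) a<n = ≤-trans (⌈/⌉≤1 (suc a) e (≤-trans a<n n≤k-1)) (1≤⌈/⌉ (suc a) (suc e) z<s)
    B′≤B : B′ ≤ B
    B′≤B = sumUpTo-mono-≤ e λ {i} _ → ^-monoʳ-≤ ℓ (⌈/⌉≤ (n ∸ suc i) (m∸n≤m n (suc i)))

  -- Let k = 2 + e, q = ⌊n/k⌋, and let c be the right-hand side; j < k gives q ≤ c. If q < c, then n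
  -- ≤ qk + (k - 1) yields n - q ≤ (q + 1)(k - 1) ≤ c(k - 1). If q = c, subtracting q from n - j ≤
  -- ck leaves c(k - 1).
  ⌈n∸n/k∸j/k-1⌉≤⌈n∸j/k⌉ : ∀ e n → j ≤ e → let q = n / (2 + e) in
    ⌈ n ∸ q ∸ j / suc e ⌉ ≤ ⌈ n ∸ j / 2 + e ⌉
  ⌈n∸n/k∸j/k-1⌉≤⌈n∸j/k⌉ {j} e n j≤e = ⌈/⌉-least (n ∸ n / (2 + e) ∸ j) e n∸q∸j≤
    where
    open ≤-Reasoning
    q = n / (2 + e)
    c = ⌈ n ∸ j / 2 + e ⌉

    q≤c : q ≤ c
    q≤c = /-monoˡ-≤ (2 + e) (begin
      n                ≤⟨ m≤n+m∸n n j ⟩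
      j + (n ∸ j)      ≡⟨ +-comm j (n ∸ j) ⟩
      n ∸ j + j        ≤⟨ +-monoʳ-≤ (n ∸ j) (m≤n⇒m≤1+n j≤e) ⟩
      n ∸ j + suc e    ∎)

    arith : ∀ x y → suc x + y * (2 + x) ≡ y + suc y * suc x
    arith = solve-∀

    n≤ : n ≤ q + suc q * suc e
    n≤ = begin
      n                               ≡⟨ m≡m%n+[m/n]*n n (2 + e) ⟩
      n % (2 + e) + q * (2 + e)       ≤⟨ +-monoˡ-≤ _ (s≤s⁻¹ (m%n<n n (2 + e))) ⟩
      suc e + q * (2 + e)             ≡⟨ arith e q ⟩
      q + suc q * suc e               ∎

    n∸q∸j≤ : n ∸ q ∸ j ≤ c * suc e
    n∸q∸j≤ with m≤n⇒m<n∨m≡n q≤c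
    ... | inj₁ q<c = begin
      n ∸ q ∸ j           ≤⟨ m∸n≤m (n ∸ q) j ⟩
      n ∸ q               ≤⟨ m≤n+o⇒m∸n≤o n q n≤ ⟩
      suc q * suc e       ≤⟨ *-monoˡ-≤ (suc e) q<c ⟩
      c * suc e           ∎
    ... | inj₂ q≡c = begin
      n ∸ q ∸ j           ≡⟨ ∸-+-assoc n q j ⟩
      n ∸ (q + j)         ≡⟨ cong (n ∸_) (+-comm q j) ⟩
      n ∸ (j + q)         ≡⟨ ∸-+-assoc n j q ⟨
      n ∸ j ∸ q           ≤⟨ ∸-monoˡ-≤ q (≤⌈/⌉* (n ∸ j) (suc e)) ⟩
      c * (2 + e) ∸ q     ≡⟨ cong (_∸ q) (*-suc c (suc e)) ⟩
      c + c * suc e ∸ q   ≡⟨ cong (c + c * suc e ∸_) q≡c ⟩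
      c + c * suc e ∸ c   ≡⟨ m+n∸m≡n c (c * suc e) ⟩
      c * suc e           ∎

  -- The numbers ⌈(n - j)/k⌉ for j < k partition n as evenly as possible;
  -- dropping the last part ⌊n/k⌋ leaves the even partition into k - 1 parts.
  f-split-≥ : ∀ e → 2 + e ≤ n →
              ℓ ^ (n / (2 + e)) + f (suc e) ℓ (n ∸ n / (2 + e)) ≤ f (2 + e) ℓ n
  f-split-≥ {n} e k≤n = begin
    ℓ ^ q + (A′ + B′)                         ≡⟨ rearrange (ℓ ^ q) A′ B′ ⟩
    A′ + (B′ + ℓ ^ q)                         ≤⟨ +-mono-≤
      (sumUpTo-monoʳ-≤ (ℓ ^_) id (⌈n∸n/k∸j/k-1⌉≤⌈n∸j/k⌉ e n z≤n))
      (+-mono-≤ (sumUpTo-mono-≤ e λ i<e → ^-monoʳ-≤ ℓ (⌈n∸n/k∸j/k-1⌉≤⌈n∸j/k⌉ e n i<e))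
                -- The summand j = k - 1 is exactly ℓ ^ q, since ⌈(n - (k - 1))/k⌉ = ⌊n/k⌋.
                (≤-reflexive (cong (ℓ ^_) (/-congˡ {o = 2 + e} (sym (m∸n+n≡m (<⇒≤ k≤n)))))) ) ⟩
    A + (sum (map g (applyUpTo suc e)) + g (suc e)) ≡⟨ cong (A +_) (sumUpTo-suc g suc e) ⟨
    f (2 + e) ℓ n                             ∎
    where
    open ≤-Reasoning
    q = n / (2 + e)
    g = λ j → ℓ ^ ⌈ n ∸ j / 2 + e ⌉
    A = sum (map (ℓ ^_) (upTo ⌈ n / 2 + e ⌉))
    A′ = sum (map (ℓ ^_) (upTo ⌈ n ∸ q / suc e ⌉))
    B′ = sum (map (λ j → ℓ ^ ⌈ n ∸ q ∸ j / suc e ⌉) (applyUpTo suc e))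
    rearrange : ∀ x y z → x + (y + z) ≡ y + (z + x)
    rearrange = solve-∀

  -- The summand j = 1 on the left is at most ℓ ^ r with r = ⌈q/k⌉, so it extends the geometric sum
  -- to r + 1 terms, and r + 1 ≤ q ≤ ⌈(n - q)/(k - 1)⌉ because q ≥ 2. The summand j + 1 on the left
  -- is compared with the summand j on the right, using q ≤ n - q.
  f-drop : ∀ {q n} e → 2 ≤ q → q * (2 + e) ≤ n → f (2 + e) ℓ q ≤ f (suc e) ℓ (n ∸ q)
  f-drop {q = q@(suc (suc p))} {n = n} e (s≤s (s≤s _)) qk≤n = begin
    A + (ℓ ^ ⌈ suc p / 2 + e ⌉ + B)   ≤⟨ +-monoʳ-≤ A (+-monoˡ-≤ B (^-monoʳ-≤ ℓ (⌈/⌉-monoˡ-≤ (suc e) (n≤1+n (suc p))))) ⟩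
    A + (ℓ ^ r + B)                   ≡⟨ +-assoc A (ℓ ^ r) B ⟨
    A + ℓ ^ r + B                     ≡⟨ cong (_+ B) (sumUpTo-suc (ℓ ^_) id r) ⟨
    sum (map (ℓ ^_) (upTo (suc r))) + B ≤⟨ +-mono-≤
       (sumUpTo-monoʳ-≤ (ℓ ^_) id (≤-trans r<q q≤))
       (sumUpTo-mono-≤ e λ {i} _ → ^-monoʳ-≤ ℓ (⌈/⌉-mono-≤
          (≤-trans (∸-monoˡ-≤ {q} (2 + i) (n≤1+n q)) (∸-monoˡ-≤ {q} (suc i) q≤n∸q)) (n≤1+n e))) ⟩
    f (suc e) ℓ (n ∸ q)               ∎
    where
    open ≤-Reasoning
    r = ⌈ q / 2 + e ⌉
    A = sum (map (ℓ ^_) (upTo r))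
    B = sum (map (λ j → ℓ ^ ⌈ q ∸ j / 2 + e ⌉) (applyUpTo (suc ∘ suc) e))
    q[k-1]≤n∸q : q * suc e ≤ n ∸ q
    q[k-1]≤n∸q = begin
      q * suc e              ≡⟨ m+n∸m≡n q (q * suc e) ⟨
      q + q * suc e ∸ q      ≡⟨ cong (_∸ q) (*-suc q (suc e)) ⟨
      q * (2 + e) ∸ q        ≤⟨ ∸-monoˡ-≤ q qk≤n ⟩
      n ∸ q                  ∎
    q≤n∸q : q ≤ n ∸ q
    q≤n∸q = ≤-trans (m≤m*n q (suc e)) q[k-1]≤n∸q
    q≤ : q ≤ ⌈ n ∸ q / suc e ⌉
    q≤ = ⌈/⌉-greatest (n ∸ q) e (≤-trans q[k-1]≤n∸q (m≤m+n (n ∸ q) e))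
    arith : ∀ x y → (2 + y) + (x + (y + x * y)) ≡ suc y * (2 + x)
    arith = solve-∀
    r<q : r < q
    r<q = s≤s (⌈/⌉-least q (suc e) (≤-trans (m≤m+n q _) (≤-reflexive (arith e p))))

f₁ : ∀ ℓ n → f 1 ℓ n ≡ sum (map (ℓ ^_) (upTo n))
f₁ ℓ n = trans (+-identityʳ _) (cong (λ m → sum (map (ℓ ^_) (upTo m)))
               (trans (n/1≡n (n + 0)) (+-identityʳ n)))

f-positive : ∀ e ℓ → 1 ≤ n → 1 ≤ f (suc e) ℓ n
f-positive {n} e ℓ 1≤n = ≤-trans
  (sumUpTo-monoʳ-≤ (ℓ ^_) id (1≤⌈/⌉ n e 1≤n))
  (m≤m+n _ _)

-- With k = e + 2 positive answers left, q + 1 is the height queried in a poset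
-- of height n; n - q bounds the height left by a positive answer.
record Split (e ℓ n q : ℕ) : Set where
  field
    1≤q     : 1 ≤ q
    q<n     : q < n
    -- Negative answers may lower the actual height m below n while q stays fixed. `low` treats
    -- queries at height 2, `high` those at height ⌊m/k⌋ + 1: in both cases a positive answer still
    -- leaves height at most n - q.
    low     : m ≤ n → m ≤ 2 + e → m + q ≤ suc n
    high    : m ≤ n → 2 + e < m → m / (2 + e) ≤ q × m + q ≤ n + m / (2 + e)
    f-split : ℓ ^ q + f (suc e) ℓ (n ∸ q) ≤ f (2 + e) ℓ n
    f-large : 2 ≤ q → f (2 + e) ℓ q ≤ f (suc e) ℓ (n ∸ q)

split : ∀ e ℓ n {{_ : NonZero ℓ}} → 2 ≤ n → ∃[ q ] Split e ℓ n q
split e ℓ n 2≤n with n <? 2 + e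
... | yes n<k = 1 , record
  { 1≤q     = ≤-refl
  ; q<n     = 2≤n
  ; low     = λ {m} m≤n _ → ≤-trans (≤-reflexive (+-comm m 1)) (s≤s m≤n)
  ; high    = λ m≤n k<m → contradiction (≤-trans k<m m≤n) (<⇒≯ n<k)
  ; f-split = f-split-< e 2≤n n<k
  ; f-large = λ { (s≤s ()) }
  }
... | no n≮k = q , record
  { 1≤q     = 1≤q
  ; q<n     = m/n<m n (2 + e) {{>-nonZero (≤-trans z<s 2≤n)}} (s≤s z<s)
  -- The bound k + q ≤ qk + 1 amounts to (k - 1)(q - 1) ≥ 0.
  ; low     = λ {m} m≤n m≤k → begin
      m + q                 ≤⟨ +-monoˡ-≤ q m≤k ⟩
      2 + e + q             ≤⟨ low 1≤q ⟩
      suc (q * (2 + e))     ≤⟨ s≤s (m/n*n≤m n (2 + e)) ⟩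
      suc n                 ∎
  ; high    = λ {m} m≤n k<m → /-monoˡ-≤ (2 + e) m≤n , (begin
      m + n / (2 + e)                    ≡⟨ cong (λ x → m + x / (2 + e)) (m+[n∸m]≡n m≤n) ⟨
      m + (m + (n ∸ m)) / (2 + e)        ≤⟨ +-monoʳ-≤ m (/-lipschitz (n ∸ m) m (suc e)) ⟩
      m + (m / (2 + e) + (n ∸ m))        ≡⟨ arith m (m / (2 + e)) (n ∸ m) ⟩
      m + (n ∸ m) + m / (2 + e)          ≡⟨ cong (_+ m / (2 + e)) (m+[n∸m]≡n m≤n) ⟩
      n + m / (2 + e)                    ∎)
  ; f-split = f-split-≥ e k≤n
  ; f-large = λ 2≤q → f-drop e 2≤q (m/n*n≤m n (2 + e))
  }
  where
  open ≤-Reasoning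
  k≤n = ≮⇒≥ n≮k
  q = n / (2 + e)
  1≤q : 1 ≤ q
  1≤q = m≥n⇒m/n>0 k≤n
  arith : ∀ x y z → x + (y + z) ≡ x + z + y
  arith = solve-∀
  arith′ : ∀ x y → (3 + x + y) + (y + x * y) ≡ suc (suc y * (2 + x))
  arith′ = solve-∀
  low : 1 ≤ a → 2 + e + a ≤ suc (a * (2 + e))
  low {suc a} _ = ≤-trans (≤-reflexive (+-suc (2 + e) a))
    (≤-trans (m≤m+n (3 + e + a) (a + e * a)) (≤-reflexive (arith′ e a)))

-- Closed bounds on `f`

geometric-< : ∀ {ℓ} → 1 < ℓ → ∀ m → sum (map (ℓ ^_) (upTo m)) < ℓ ^ m
geometric-< 1<ℓ zero    = z<s
geometric-< {ℓ} 1<ℓ (suc m) = begin-strict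
  sum (map (ℓ ^_) (upTo (suc m)))     ≡⟨ sumUpTo-suc (ℓ ^_) id m ⟩
  sum (map (ℓ ^_) (upTo m)) + ℓ ^ m   <⟨ +-monoˡ-< (ℓ ^ m) (geometric-< 1<ℓ m) ⟩
  ℓ ^ m + ℓ ^ m                       ≡⟨ cong (ℓ ^ m +_) (+-identityʳ (ℓ ^ m)) ⟨
  2 * ℓ ^ m                           ≤⟨ *-monoˡ-≤ (ℓ ^ m) 1<ℓ ⟩
  ℓ ^ suc m                           ∎
  where open ≤-Reasoning

f-bound-1 : ∀ e n → f (suc e) 1 n ≤ ⌈ n / suc e ⌉ + suc e ∸ 1
f-bound-1 e n = begin
  f (suc e) 1 n                    ≤⟨ +-mono-≤
    (sumUpTo-≤-* {o = 1} (1 ^_) id ⌈ n / suc e ⌉ λ {i} _ → ≤-reflexive (^-zeroˡ i))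
    (sumUpTo-≤-* {o = 1} (λ j → 1 ^ ⌈ n ∸ j / suc e ⌉) suc e λ {i} _ → ≤-reflexive (^-zeroˡ ⌈ n ∸ suc i / suc e ⌉)) ⟩
  ⌈ n / suc e ⌉ * 1 + e * 1        ≡⟨ arith ⌈ n / suc e ⌉ e ⟩
  ⌈ n / suc e ⌉ + e                ≡⟨ +-∸-assoc ⌈ n / suc e ⌉ {suc e} (s≤s z≤n) ⟨
  ⌈ n / suc e ⌉ + suc e ∸ 1        ∎
  where
  open ≤-Reasoning
  arith : ∀ x y → x * 1 + y * 1 ≡ x + y
  arith = solve-∀

-- For ℓ > 1 the whole geometric sum stays below its next power, so it counts as one of k terms,
-- each at most ℓ ^ ⌈n/k⌉.
f-bound->1 : ∀ e ℓ n → 1 < ℓ → f (suc e) ℓ n ≤ suc e * ℓ ^ ⌈ n / suc e ⌉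
f-bound->1 e ℓ n 1<ℓ = +-mono-≤
  (<⇒≤ (geometric-< 1<ℓ ⌈ n / suc e ⌉))
  (sumUpTo-≤-* (λ j → ℓ ^ ⌈ n ∸ j / suc e ⌉) suc e
    λ {i} _ → ^-monoʳ-≤ ℓ {{>-nonZero (<⇒≤ 1<ℓ)}} (⌈/⌉-monoˡ-≤ e (m∸n≤m n (suc i))))

-- Chains and levels

∣p∪q∣+∣p∩q∣≡∣p∣+∣q∣ : ∀ {n} (p q : Subset n) → ∣ p ∪ q ∣ + ∣ p ∩ q ∣ ≡ ∣ p ∣ + ∣ q ∣
∣p∪q∣+∣p∩q∣≡∣p∣+∣q∣ []            []            = refl
∣p∪q∣+∣p∩q∣≡∣p∣+∣q∣ (outside ∷ p) (outside ∷ q) = ∣p∪q∣+∣p∩q∣≡∣p∣+∣q∣ p q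
∣p∪q∣+∣p∩q∣≡∣p∣+∣q∣ (outside ∷ p) (inside  ∷ q) =
  trans (cong suc (∣p∪q∣+∣p∩q∣≡∣p∣+∣q∣ p q)) (sym (+-suc ∣ p ∣ ∣ q ∣))
∣p∪q∣+∣p∩q∣≡∣p∣+∣q∣ (inside  ∷ p) (outside ∷ q) = cong suc (∣p∪q∣+∣p∩q∣≡∣p∣+∣q∣ p q)
∣p∪q∣+∣p∩q∣≡∣p∣+∣q∣ (inside  ∷ p) (inside  ∷ q) =
  cong suc (trans (+-suc _ _) (trans (cong suc (∣p∪q∣+∣p∩q∣≡∣p∣+∣q∣ p q)) (sym (+-suc ∣ p ∣ ∣ q ∣))))

module _ {N} {P : Pred (Fin N) 0ℓ} (P? : Decidable P) where

  ∈⟦⟧⁺ : ∀ {v} → P v → v ∈ ⟦ P? ⟧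
  ∈⟦⟧⁺ {v} Pv = lookup⇒[]= v _ (trans (lookup∘tabulate _ v) (dec-true (P? v) Pv))

  ∈⟦⟧⁻ : ∀ {v} → v ∈ ⟦ P? ⟧ → P v
  ∈⟦⟧⁻ {v} v∈ with P? v | trans (sym (lookup∘tabulate (does ∘ P?) v)) ([]=⇒lookup v∈)
  ... | yes Pv | _  = Pv
  ... | no  _  | ()

module _ {A : Set} where

  -- Links the lists in which levels are counted to the subset cardinality that defines
  -- `nodeDegree`.
  length-filter-tabulate : ∀ {N} {P : Pred A 0ℓ} (P? : Decidable P) (g : Fin N → A) →
    length (filter P? (List.tabulate g)) ≡ ∣ tabulate (does ∘ P? ∘ g) ∣
  length-filter-tabulate {zero}  P? g = refl
  length-filter-tabulate {suc N} P? g with does (P? (g Fin.zero))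
  ... | inside  = cong suc (length-filter-tabulate P? (g ∘ Fin.suc))
  ... | outside = length-filter-tabulate P? (g ∘ Fin.suc)

  length-concatMap-≤ : ∀ {B : Set} {g : A → List B} {c} → (∀ x → length (g x) ≤ c) →
                       ∀ xs → length (concatMap g xs) ≤ length xs * c
  length-concatMap-≤ g≤c []       = z≤n
  length-concatMap-≤ {g = g} g≤c (x ∷ xs) = ≤-trans
    (≤-reflexive (length-++ (g x)))
    (+-mono-≤ (g≤c x) (length-concatMap-≤ g≤c xs))

  ∈⇒1≤length : ∀ {x : A} {xs} → x ∈ˡ xs → 1 ≤ length xs
  ∈⇒1≤length (here _)  = z<s
  ∈⇒1≤length (there _) = z<s

length-concatMap-≤-sum : ∀ {A B : Set} {g : A → List B} {c : A → ℕ} → (∀ x → length (g x) ≤ c x) →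
                         ∀ xs → length (concatMap g xs) ≤ sum (map c xs)
length-concatMap-≤-sum g≤c []       = z≤n
length-concatMap-≤-sum {g = g} g≤c (x ∷ xs) = ≤-trans
  (≤-reflexive (length-++ (g x)))
  (+-mono-≤ (g≤c x) (length-concatMap-≤-sum g≤c xs))

module Order (P : FinPoset) where

  open FinPoset P
  open IsDecPartialOrder isDecPartialOrder
    using (antisym) renaming (refl to ≼-refl; reflexive to ≼-reflexive; trans to ≼-trans)

  private
    variable
      Λ C D : Nodes
      b u v x : Node
      h : ℕ

  covers : Node → List Node
  covers v = filter (_covers? v) (allFin size)

  -- Repetitions are kept: they cost nothing in the bound degree ^ i.
  level : ℕ → Node → List Node
  level zero    b = b ∷ []
  level (suc i) b = concatMap covers (level i b)

  length-covers : ∀ v → length (covers v) ≤ degree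
  length-covers v = begin
    length (covers v)   ≡⟨ length-filter-tabulate (_covers? v) id ⟩
    nodeDegree v        ≤⟨ All.lookup (xs≤max 0 (map nodeDegree (allFin size))) (∈-map⁺ nodeDegree (∈-allFin v)) ⟩
    degree              ∎
    where open ≤-Reasoning

  length-level : ∀ i b → length (level i b) ≤ degree ^ i
  length-level zero    b = ≤-refl
  length-level (suc i) b = begin
    length (level (suc i) b)      ≤⟨ length-concatMap-≤ length-covers (level i b) ⟩
    length (level i b) * degree   ≤⟨ *-monoˡ-≤ degree (length-level i b) ⟩
    degree ^ i * degree           ≡⟨ *-comm (degree ^ i) degree ⟩
    degree ^ suc i                ∎
    where open ≤-Reasoning

  -- Convexity ensures that a cover inside Λ is a cover in the whole poset, so that the degree of
  -- the whole poset bounds the branching in every Λ met during a run.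
  record PointedAt (Λ : Nodes) (b : Node) : Set where
    field
      base∈  : b ∈ Λ
      least  : u ∈ Λ → b ≼ u
      convex : b ≼ x → x ≼ u → u ∈ Λ → x ∈ Λ

  HeightAtMost : Nodes → ℕ → Set
  HeightAtMost Λ n = ∀ D → ChainIn Λ D → ∣ D ∣ ≤ n

  ∈↓⁺ : u ≼ v → u ∈ ↓ v
  ∈↓⁺ {v = v} = ∈⟦⟧⁺ (λ u → u ≼? v)

  ∈↓⁻ : u ∈ ↓ v → u ≼ v
  ∈↓⁻ {v = v} = ∈⟦⟧⁻ (λ u → u ≼? v)

  ∈∩↓⁺ : u ∈ C → u ≼ v → u ∈ C ∩ ↓ v
  ∈∩↓⁺ u∈C u≼v = x∈p∩q⁺ (u∈C , ∈↓⁺ u≼v)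

  _∩⋠_ : Nodes → Node → Nodes
  C ∩⋠ u = C ∩ ⟦ (λ x → ¬? (x ≼? u)) ⟧

  ∈∩⋠⁺ : x ∈ C → ¬ x ≼ u → x ∈ C ∩⋠ u
  ∈∩⋠⁺ {u = u} x∈C x⋠u = x∈p∩q⁺ (x∈C , ∈⟦⟧⁺ (λ x → ¬? (x ≼? u)) x⋠u)

  ∈∩⋠⁻ : x ∈ C ∩⋠ u → x ∈ C × ¬ x ≼ u
  ∈∩⋠⁻ {C = C} {u = u} x∈ with x∈C , x∈′ ← x∈p∩q⁻ C _ x∈ = x∈C , ∈⟦⟧⁻ (λ x → ¬? (x ≼? u)) x∈′

  ∈≽⁺ : u ∈ Λ → v ≼ u → u ∈ Λ ≽[ v ]
  ∈≽⁺ {v = v} u∈Λ v≼u = x∈p∩q⁺ (u∈Λ , ∈⟦⟧⁺ (λ u → v ≼? u) v≼u)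

  ∈≽⁻ : u ∈ Λ ≽[ v ] → u ∈ Λ × v ≼ u
  ∈≽⁻ {Λ = Λ} {v = v} u∈ with x∈p∩q⁻ Λ _ u∈
  ... | u∈Λ , u∈↑ = u∈Λ , ∈⟦⟧⁻ (λ u → v ≼? u) u∈↑

  ∈⋡⁺ : u ∈ Λ → ¬ v ≼ u → u ∈ Λ ⋡[ v ]
  ∈⋡⁺ {v = v} u∈Λ v⋠u = x∈p∩q⁺ (u∈Λ , ∈⟦⟧⁺ (λ u → ¬? (v ≼? u)) v⋠u)

  ∈⋡⁻ : u ∈ Λ ⋡[ v ] → u ∈ Λ × ¬ v ≼ u
  ∈⋡⁻ {Λ = Λ} {v = v} u∈ with x∈p∩q⁻ Λ _ u∈
  ... | u∈Λ , u∉↑ = u∈Λ , ∈⟦⟧⁻ (λ u → ¬? (v ≼? u)) u∉↑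

  chain-∪ : ChainIn Λ C → ChainIn Λ D → (∀ {u v} → u ∈ C → v ∈ D → u ≼ v ⊎ v ≼ u) →
            ChainIn Λ (C ∪ D)
  chain-∪ {Λ} {C} {D} (C⊆Λ , chainC) (D⊆Λ , chainD) cmp = sub , chain
    where
    sub : C ∪ D ⊆ Λ
    sub x∈ with x∈p∪q⁻ C D x∈
    ... | inj₁ x∈C = C⊆Λ x∈C
    ... | inj₂ x∈D = D⊆Λ x∈D
    chain : IsChain (C ∪ D)
    chain u∈ v∈ with x∈p∪q⁻ C D u∈ | x∈p∪q⁻ C D v∈
    ... | inj₁ u∈C | inj₁ v∈C = chainC u∈C v∈C
    ... | inj₁ u∈C | inj₂ v∈D = cmp u∈C v∈D
    ... | inj₂ u∈D | inj₁ v∈C = swap (cmp v∈C u∈D)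
    ... | inj₂ u∈D | inj₂ v∈D = chainD u∈D v∈D

  chain-⁅⁆ : v ∈ Λ → ChainIn Λ ⁅ v ⁆
  chain-⁅⁆ {v} {Λ} v∈Λ =
    (λ x∈ → subst (_∈ Λ) (sym (x∈⁅y⁆⇒x≡y v x∈)) v∈Λ) ,
    λ x∈ y∈ → inj₁ (≼-reflexive (trans (x∈⁅y⁆⇒x≡y v x∈) (sym (x∈⁅y⁆⇒x≡y v y∈))))

  chain-⊆ : D ⊆ C → ChainIn Λ C → ChainIn Λ D
  chain-⊆ D⊆C (C⊆Λ , chain) = C⊆Λ ∘ D⊆C , λ u∈ v∈ → chain (D⊆C u∈) (D⊆C v∈)

  -- Otherwise adjoining x to C would give a larger chain.
  maximal-∋ : MaximalChain Λ C → x ∈ Λ → (∀ {y} → y ∈ C → y ≼ x ⊎ x ≼ y) → x ∈ C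
  maximal-∋ {Λ} {C} {x} (chain , maximal) x∈Λ cmp = decidable-stable (x ∈? C) λ x∉C →
    contradiction
      (maximal (C ∪ ⁅ x ⁆) (chain-∪ chain (chain-⁅⁆ x∈Λ)
        λ {y} y∈C z∈ → subst (λ z → y ≼ z ⊎ z ≼ y) (sym (x∈⁅y⁆⇒x≡y x z∈)) (cmp y∈C)))
      (<⇒≱ (p⊂q⇒∣p∣<∣q∣ (p⊆p∪q ⁅ x ⁆ , x , q⊆p∪q C ⁅ x ⁆ (x∈⁅x⁆ x) , x∉C)))

  -- If some x in C is not above s, then x ≼ s, and s can be discarded: the least element of the
  -- rest lies below x, hence below s.
  chain-least : IsChain C → Nonempty C → ∃[ w ] w ∈ C × (∀ {x} → x ∈ C → w ≼ x)
  chain-least {C} = go C (<-wellFounded ∣ C ∣)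
    where
    go : ∀ C → Acc _<_ ∣ C ∣ → IsChain C → Nonempty C → ∃[ w ] w ∈ C × (∀ {x} → x ∈ C → w ≼ x)
    go C (acc rec) chain (s , s∈C) with any? (λ x → (x ∈? C) ×-dec ¬? (s ≼? x))
    ... | no ∄x = s , s∈C , λ {x} x∈C → decidable-stable (s ≼? x) λ s⋠x → ∄x (x , x∈C , s⋠x)
    ... | yes (x , x∈C , s⋠x)
        with w , w∈ , w≼ ← go (C - s) (rec (x∈p⇒∣p-x∣<∣p∣ s∈C))
                 (λ u∈ v∈ → chain (p─q⊆p C ⁅ s ⁆ u∈) (p─q⊆p C ⁅ s ⁆ v∈))
                 (x , x∈p∧x≢y⇒x∈p-y x∈C (λ x≡s → s⋠x (≼-reflexive (sym x≡s))))
        = w , p─q⊆p C ⁅ s ⁆ w∈ , below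
      where
      x≼s : x ≼ s
      x≼s with chain x∈C s∈C
      ... | inj₁ x≼s = x≼s
      ... | inj₂ s≼x = contradiction s≼x s⋠x
      below : ∀ {y} → y ∈ C → w ≼ y
      below {y} y∈C with y ≟ₚ s
      ... | yes refl = ≼-trans (w≼ (x∈p∧x≢y⇒x∈p-y x∈C (λ x≡s → s⋠x (≼-reflexive (sym x≡s))))) x≼s
      ... | no  y≢s  = w≼ (x∈p∧x≢y⇒x∈p-y y∈C y≢s)

  -- The witness w is the least element of C not below u. A node strictly between u and w would be
  -- comparable to all of C, hence belong to C, and then lie below u or above w.
  maximal-cover : PointedAt Λ b → MaximalChain Λ C → u ∈ C → x ∈ C → ¬ x ≼ u →
                  ∃[ w ] w ∈ C × w Covers u × (∀ {y} → y ∈ C → y ≼ u ⊎ w ≼ y)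
  maximal-cover {Λ} {b} {C} {u} {x} pt maxC@((C⊆Λ , chain) , _) u∈C x∈C x⋠u
    with w , w∈ , w≼ ← chain-least (λ u∈ v∈ → chain (p∩q⊆p C _ u∈) (p∩q⊆p C _ v∈))
                         (x , ∈∩⋠⁺ x∈C x⋠u)
    with w∈C , w⋠u ← ∈∩⋠⁻ w∈
    = w , w∈C , ((u≼w w∈C w⋠u , λ u≡w → w⋠u (≼-reflexive (sym u≡w))) , no-between w∈C w≼) , above w≼
    where
    open PointedAt pt
    above : ∀ {w} → (∀ {y} → y ∈ C ∩⋠ u → w ≼ y) → ∀ {y} → y ∈ C → y ≼ u ⊎ w ≼ y
    above w≼ {y} y∈C with y ≼? u
    ... | yes y≼u = inj₁ y≼u
    ... | no  y⋠u = inj₂ (w≼ (∈∩⋠⁺ y∈C y⋠u))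
    u≼w : ∀ {w} → w ∈ C → ¬ w ≼ u → u ≼ w
    u≼w w∈C w⋠u with chain u∈C w∈C
    ... | inj₁ u≼w = u≼w
    ... | inj₂ w≼u = contradiction w≼u w⋠u
    no-between : ∀ {w} → w ∈ C → (∀ {y} → y ∈ C ∩⋠ u → w ≼ y) → ¬ (∃[ z ] u ≺ z × z ≺ w)
    no-between {w} w∈C w≼ (z , (u≼z , u≢z) , (z≼w , z≢w)) with above w≼ (maximal-∋ maxC z∈Λ cmp)
      where
      z∈Λ : z ∈ Λ
      z∈Λ = convex (≼-trans (least (C⊆Λ u∈C)) u≼z) z≼w (C⊆Λ w∈C)
      cmp : ∀ {y} → y ∈ C → y ≼ z ⊎ z ≼ y
      cmp y∈C with above w≼ y∈C
      ... | inj₁ y≼u = inj₁ (≼-trans y≼u u≼z)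
      ... | inj₂ w≼y = inj₂ (≼-trans z≼w w≼y)
    ... | inj₁ z≼u = u≢z (antisym u≼z z≼u)
    ... | inj₂ w≼z = z≢w (antisym z≼w w≼z)

  ↓-⊂ : v ∈ C → u ≼ v → ¬ v ≼ u → ∣ C ∩ ↓ u ∣ < ∣ C ∩ ↓ v ∣
  ↓-⊂ {v} {C} v∈C u≼v v⋠u = p⊂q⇒∣p∣<∣q∣
    ( (λ x∈ → let x∈C , x∈↓u = x∈p∩q⁻ C _ x∈ in ∈∩↓⁺ x∈C (≼-trans (∈↓⁻ x∈↓u) u≼v))
    , v , ∈∩↓⁺ v∈C ≼-refl , λ v∈ → v⋠u (∈↓⁻ (p∩q⊆q C _ v∈)))

  -- C starts at the base, and each of its elements is covered by the next one, so climbing C is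
  -- climbing the levels. The cardinality of `C ∩ ↓ u` records the position of u in C, for
  -- comparison with node heights.
  maximal-level : PointedAt Λ b → MaximalChain Λ C → ∀ i → i < ∣ C ∣ →
                  ∃[ u ] u ∈ C × u ∈ˡ level i b × ∣ C ∩ ↓ u ∣ ≡ suc i
  maximal-level {Λ} {b} {C} pt maxC@((C⊆Λ , chain) , maximal) zero _ =
    b , b∈C , here refl , trans (≤-antisym (p⊆q⇒∣p∣≤∣q∣ ⊆⁅b⁆) (p⊆q⇒∣p∣≤∣q∣ ⁅b⁆⊆)) (∣⁅x⁆∣≡1 b)
    where
    open PointedAt pt
    b∈C : b ∈ C
    b∈C = maximal-∋ maxC base∈ λ y∈C → inj₂ (least (C⊆Λ y∈C))
    ⊆⁅b⁆ : C ∩ ↓ b ⊆ ⁅ b ⁆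
    ⊆⁅b⁆ x∈ with x∈C , x∈↓ ← x∈p∩q⁻ C _ x∈ =
      subst (_∈ ⁅ b ⁆) (antisym (least (C⊆Λ x∈C)) (∈↓⁻ x∈↓)) (x∈⁅x⁆ b)
    ⁅b⁆⊆ : ⁅ b ⁆ ⊆ C ∩ ↓ b
    ⁅b⁆⊆ x∈ = subst (_∈ C ∩ ↓ b) (sym (x∈⁅y⁆⇒x≡y b x∈)) (∈∩↓⁺ b∈C ≼-refl)
  maximal-level {Λ} {b} {C} pt maxC@((C⊆Λ , chain) , maximal) (suc i) 1+i<∣C∣
    with u , u∈C , u∈level , ∣C∩↓u∣ ← maximal-level pt maxC i (<-trans ≤-refl 1+i<∣C∣)
    with any? (λ x → (x ∈? C) ×-dec ¬? (x ≼? u))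
  ... | no ∄x = contradiction
      (subst (∣ C ∣ ≤_) ∣C∩↓u∣ (p⊆q⇒∣p∣≤∣q∣ λ {x} x∈C → ∈∩↓⁺ x∈C
         (decidable-stable (x ≼? u) λ x⋠u → ∄x (x , x∈C , x⋠u))))
      (<⇒≱ 1+i<∣C∣)
  ... | yes (x , x∈C , x⋠u)
    with w , w∈C , w-covers-u , split ← maximal-cover pt maxC u∈C x∈C x⋠u
    with (u≼w , u≢w) , _ ← w-covers-u
    = w , w∈C , w∈level , ≤-antisym (≤2+i u w ∣C∩↓u∣ split)
        (subst (_< ∣ C ∩ ↓ w ∣) ∣C∩↓u∣ (↓-⊂ w∈C u≼w λ w≼u → u≢w (antisym u≼w w≼u)))
    where
    w∈level : w ∈ˡ level (suc i) b
    w∈level = ∈-concatMap⁺ covers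
      (Any.map (λ { refl → ∈-filter⁺ (_covers? u) (∈-allFin w) w-covers-u }) u∈level)
    ≤2+i : ∀ u w → ∣ C ∩ ↓ u ∣ ≡ suc i → (∀ {y} → y ∈ C → y ≼ u ⊎ w ≼ y) → ∣ C ∩ ↓ w ∣ ≤ 2 + i
    ≤2+i u w ∣C∩↓u∣ split = begin
      ∣ C ∩ ↓ w ∣                                         ≤⟨ p⊆q⇒∣p∣≤∣q∣ sub ⟩
      ∣ (C ∩ ↓ u) ∪ ⁅ w ⁆ ∣                               ≤⟨ m≤m+n _ _ ⟩
      ∣ (C ∩ ↓ u) ∪ ⁅ w ⁆ ∣ + ∣ (C ∩ ↓ u) ∩ ⁅ w ⁆ ∣       ≡⟨ ∣p∪q∣+∣p∩q∣≡∣p∣+∣q∣ (C ∩ ↓ u) ⁅ w ⁆ ⟩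
      ∣ C ∩ ↓ u ∣ + ∣ ⁅ w ⁆ ∣                             ≡⟨ cong (∣ C ∩ ↓ u ∣ +_) (∣⁅x⁆∣≡1 w) ⟩
      ∣ C ∩ ↓ u ∣ + 1                                     ≡⟨ cong (_+ 1) ∣C∩↓u∣ ⟩
      suc i + 1                                           ≡⟨ +-comm (suc i) 1 ⟩
      2 + i                                               ∎
      where
      open ≤-Reasoning
      sub : C ∩ ↓ w ⊆ (C ∩ ↓ u) ∪ ⁅ w ⁆
      sub x∈ with x∈p∩q⁻ C _ x∈
      ... | x∈C , x∈↓w with split x∈C
      ... | inj₁ x≼u = p⊆p∪q _ (∈∩↓⁺ x∈C x≼u)
      ... | inj₂ w≼x = q⊆p∪q (C ∩ ↓ u) _
        (subst (_∈ ⁅ w ⁆) (antisym w≼x (∈↓⁻ x∈↓w)) (x∈⁅x⁆ w))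

  -- Heights of posets and of nodes

  maximal-size : HasHeight Λ n → MaximalChain Λ C → ∣ C ∣ ≡ n
  maximal-size (D , (chainD , maxD) , refl) (chainC , maxC) = ≤-antisym (maxD _ chainC) (maxC _ chainD)

  height-atMost : HasHeight Λ n → HeightAtMost Λ n
  height-atMost (C , (_ , maximal) , refl) = maximal

  height-≤ : HasHeight Λ n → HeightAtMost Λ m → n ≤ m
  height-≤ (C , (chain , _) , refl) ≤m = ≤m C chain

  nodeHeight-∈ : HasNodeHeight Λ v h → v ∈ Λ
  nodeHeight-∈ (C , ((C⊆Λ , _) , v∈C , _) , _) = C⊆Λ v∈C

  -- A chain with top b consists of b alone. Since queries have height at least 2, the base survives
  -- every negative answer.
  nodeHeight-≢base : PointedAt Λ b → HasNodeHeight Λ v h → 2 ≤ h → v ≢ b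
  nodeHeight-≢base {b = b} pt (C , ((C⊆Λ , _) , _ , C≼v) , _ , refl) 2≤h refl =
    contradiction (subst (∣ C ∣ ≤_) (∣⁅x⁆∣≡1 b) (p⊆q⇒∣p∣≤∣q∣ λ {x} x∈C →
      subst (_∈ ⁅ b ⁆) (antisym (PointedAt.least pt (C⊆Λ x∈C)) (C≼v x∈C)) (x∈⁅x⁆ b))) (<⇒≱ 2≤h)

  -- The chain below v and any chain above v share at most v.
  ≽-height : HasNodeHeight Λ v h → HeightAtMost Λ n → suc n ≤ m + h → HeightAtMost (Λ ≽[ v ]) m
  ≽-height {Λ} {v} {h} {n} {m} (E , ((E⊆Λ , chainE) , v∈E , E≼v) , _ , refl) ≤n n<m+h D (D⊆ , chainD) =
    +-cancelʳ-≤ h _ _ (begin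
      ∣ D ∣ + ∣ E ∣             ≡⟨ ∣p∪q∣+∣p∩q∣≡∣p∣+∣q∣ D E ⟨
      ∣ D ∪ E ∣ + ∣ D ∩ E ∣     ≤⟨ +-mono-≤ (≤n (D ∪ E) D∪E) (p⊆q⇒∣p∣≤∣q∣ D∩E⊆) ⟩
      n + ∣ ⁅ v ⁆ ∣             ≡⟨ cong (n +_) (∣⁅x⁆∣≡1 v) ⟩
      n + 1                     ≡⟨ +-comm n 1 ⟩
      suc n                     ≤⟨ n<m+h ⟩
      m + h                     ∎)
    where
    open ≤-Reasoning
    D≽v : ∀ {x} → x ∈ D → x ∈ Λ × v ≼ x
    D≽v = ∈≽⁻ ∘ D⊆
    D∪E : ChainIn Λ (D ∪ E)
    D∪E = chain-∪ (proj₁ ∘ D≽v , chainD) (E⊆Λ , chainE)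
            λ x∈D y∈E → inj₂ (≼-trans (E≼v y∈E) (proj₂ (D≽v x∈D)))
    D∩E⊆ : D ∩ E ⊆ ⁅ v ⁆
    D∩E⊆ x∈ with x∈D , x∈E ← x∈p∩q⁻ D E x∈ =
      subst (_∈ ⁅ v ⁆) (antisym (proj₂ (D≽v x∈D)) (E≼v x∈E)) (x∈⁅x⁆ v)

  -- The maximum chain through v meets level q at some u. Were v not below u, the part of the chain
  -- up to v would have more than q + 1 elements, exceeding the height of v.
  level-above : ∀ {q} → PointedAt Λ b → HasHeight Λ n → q < n → OnMaximalChain Λ v →
                HasNodeHeight Λ v h → h ≤ suc q → ∃[ u ] u ∈ Λ × u ∈ˡ level q b × v ≼ u
  level-above {v = v} {q = q} pt hasHeight q<n (C , maxC@(chainC@(C⊆Λ , chain) , _) , v∈C) (E , _ , maxE , refl) h≤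
    with u , u∈C , u∈level , ∣C∩↓u∣ ← maximal-level pt maxC q (subst (q <_) (sym (maximal-size hasHeight maxC)) q<n)
    with chain v∈C u∈C
  ... | inj₁ v≼u = u , C⊆Λ u∈C , u∈level , v≼u
  ... | inj₂ u≼v = u , C⊆Λ u∈C , u∈level , decidable-stable (v ≼? u) λ v⋠u →
    contradiction
      (≤-trans (maxE (C ∩ ↓ v) (chain-⊆ (p∩q⊆p C _) chainC , ∈∩↓⁺ v∈C ≼-refl , ∈↓⁻ ∘ p∩q⊆q C _)) h≤)
      (<⇒≱ (subst (_< ∣ C ∩ ↓ v ∣) ∣C∩↓u∣ (↓-⊂ v∈C u≼v v⋠u)))

  -- A chain witnessing the height of v has maximum cardinality n, so its element on level n - 1 is
  -- its top v.
  level-top : PointedAt Λ b → HasHeight Λ n → HasNodeHeight Λ v n →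
              ∃[ i ] i < n × v ∈ˡ level i b
  level-top {v = v} pt hasHeight (E , (chainE@(E⊆Λ , chain) , v∈E , E≼v) , _ , refl)
    with ∣ E ∣ in eq
  ... | zero = contradiction (x∈p⇒∣p-x∣<∣p∣ v∈E) (subst (∣ E - v ∣ ≮_) (sym eq) n≮0)
  ... | suc i
    with u , u∈E , u∈level , ∣E∩↓u∣ ← maximal-level pt
           (chainE , λ D chainD → subst (∣ D ∣ ≤_) (sym eq) (height-atMost hasHeight D chainD)) i
           (subst (i <_) (sym eq) ≤-refl)
    = i , ≤-refl , subst (_∈ˡ level i _) (antisym (E≼v u∈E) v≼u) u∈level
    where
    v≼u : v ≼ u
    v≼u = decidable-stable (v ≼? u) λ v⋠u → contradiction (trans eq (sym ∣E∩↓u∣))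
      (>⇒≢ (p⊂q⇒∣p∣<∣q∣ (p∩q⊆p E _ , v , v∈E , λ v∈ → v⋠u (∈↓⁻ (p∩q⊆q E _ v∈)))))

  -- Guarantees an admissible query: the element in position h of a maximum chain has height exactly
  -- h.
  node-at-height : PointedAt Λ b → HasHeight Λ n → 1 ≤ h → h ≤ n →
                   ∃[ v ] OnMaximalChain Λ v × HasNodeHeight Λ v h
  node-at-height {h = suc i} pt (C , maxC@(chainC@(C⊆Λ , chain) , maximal) , refl) _ i<n
    with u , u∈C , _ , ∣C∩↓u∣ ← maximal-level pt maxC i i<n
    = u , (C , maxC , u∈C) , C ∩ ↓ u
    , (chain-⊆ (p∩q⊆p C _) chainC , ∈∩↓⁺ u∈C ≼-refl , ∈↓⁻ ∘ p∩q⊆q C _) , largest , ∣C∩↓u∣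
    where
    R = C ∩⋠ u
    R⁻ : ∀ {x} → x ∈ R → u ≼ x × ¬ x ≼ u
    R⁻ x∈ with x∈C , x⋠u ← ∈∩⋠⁻ x∈ with chain u∈C x∈C
    ... | inj₁ u≼x = u≼x , x⋠u
    ... | inj₂ x≼u = contradiction x≼u x⋠u
    C⊆ : C ⊆ (C ∩ ↓ u) ∪ R
    C⊆ {x} x∈C with x ≼? u
    ... | yes x≼u = p⊆p∪q R (∈∩↓⁺ x∈C x≼u)
    ... | no  x⋠u = q⊆p∪q (C ∩ ↓ u) R (∈∩⋠⁺ x∈C x⋠u)
    -- Replacing the part of C up to u by D gives a chain again.
    largest : ∀ D → ChainWithTop _ u D → ∣ D ∣ ≤ ∣ C ∩ ↓ u ∣
    largest D (chainD , u∈D , D≼u) = +-cancelʳ-≤ ∣ R ∣ _ _ (begin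
      ∣ D ∣ + ∣ R ∣                                 ≡⟨ ∣p∪q∣+∣p∩q∣≡∣p∣+∣q∣ D R ⟨
      ∣ D ∪ R ∣ + ∣ D ∩ R ∣                         ≤⟨ +-mono-≤ (maximal (D ∪ R) D∪R) (p⊆q⇒∣p∣≤∣q∣ D∩R⊆) ⟩
      ∣ C ∣ + ∣ ∅ {size} ∣          ≡⟨ cong (∣ C ∣ +_) (∣⊥∣≡0 size) ⟩
      ∣ C ∣ + 0                                     ≡⟨ +-identityʳ ∣ C ∣ ⟩
      ∣ C ∣                                         ≤⟨ p⊆q⇒∣p∣≤∣q∣ C⊆ ⟩
      ∣ (C ∩ ↓ u) ∪ R ∣                             ≤⟨ m≤m+n _ _ ⟩
      ∣ (C ∩ ↓ u) ∪ R ∣ + ∣ (C ∩ ↓ u) ∩ R ∣         ≡⟨ ∣p∪q∣+∣p∩q∣≡∣p∣+∣q∣ (C ∩ ↓ u) R ⟩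
      ∣ C ∩ ↓ u ∣ + ∣ R ∣                           ∎)
      where
      open ≤-Reasoning
      D∪R = chain-∪ chainD (chain-⊆ (p∩q⊆p C _) chainC)
              λ x∈D y∈R → inj₁ (≼-trans (D≼u x∈D) (proj₁ (R⁻ y∈R)))
      D∩R⊆ : D ∩ R ⊆ ∅
      D∩R⊆ x∈ with x∈D , x∈R ← x∈p∩q⁻ D R x∈ = contradiction (D≼u x∈D) (proj₂ (R⁻ x∈R))

  -- If no chain had maximum cardinality, chains could be enlarged past `size`. The double negation
  -- suffices because it serves to refute that a running state is stuck, and it avoids a search
  -- through all chains.
  ¬¬-hasHeight : ¬ ¬ (∃[ n ] HasHeight Λ n)
  ¬¬-hasHeight {Λ} ∄height = go (size ∸ ∣ ∅ {size} ∣) ∅ (⊥⊆ , λ x∈ → contradiction x∈ ∉⊥) ≤-refl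
    where
    go : ∀ d C → ChainIn Λ C → size ∸ ∣ C ∣ ≤ d → Absurd
    go d C chain d≥ = ∄height (∣ C ∣ , C , (chain , maximal d d≥) , refl)
      where
      maximal : ∀ d → size ∸ ∣ C ∣ ≤ d → ∀ D → ChainIn Λ D → ∣ D ∣ ≤ ∣ C ∣
      maximal zero    d≥ D chainD = ≤-trans (∣p∣≤n D) (m∸n≡0⇒m≤n (n≤0⇒n≡0 d≥))
      maximal (suc d) d≥ D chainD with ∣ D ∣ ≤? ∣ C ∣
      ... | yes D≤C = D≤C
      ... | no  D≰C = contradiction
        (s≤s⁻¹ (≤-trans (∸-monoʳ-< (≰⇒> D≰C) (∣p∣≤n D)) d≥)) λ d≥ → go d D chainD d≥

  -- Posets left by an answer

  two-chain : PointedAt Λ b → 1 < ∣ Λ ∣ → ∃[ D ] ChainIn Λ D × 2 ≤ ∣ D ∣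
  two-chain {Λ} {b} pt 1<∣Λ∣ with any? (λ u → (u ∈? Λ) ×-dec ¬? (u ≟ₚ b))
  ... | no ∄u = contradiction
    (subst (∣ Λ ∣ ≤_) (∣⁅x⁆∣≡1 b) (p⊆q⇒∣p∣≤∣q∣ λ {x} x∈Λ → subst (_∈ ⁅ b ⁆)
       (sym (decidable-stable (x ≟ₚ b) λ x≢b → ∄u (x , x∈Λ , x≢b))) (x∈⁅x⁆ b)))
    (<⇒≱ 1<∣Λ∣)
  ... | yes (u , u∈Λ , u≢b) = ⁅ b ⁆ ∪ ⁅ u ⁆
    , chain-∪ (chain-⁅⁆ base∈) (chain-⁅⁆ u∈Λ) (λ x∈ y∈ → inj₁ (≼-trans (≼-reflexive (x∈⁅y⁆⇒x≡y b x∈))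
        (≼-trans (least u∈Λ) (≼-reflexive (sym (x∈⁅y⁆⇒x≡y u y∈))))))
    , subst (_< ∣ ⁅ b ⁆ ∪ ⁅ u ⁆ ∣) (∣⁅x⁆∣≡1 b) (p⊂q⇒∣p∣<∣q∣
        (p⊆p∪q ⁅ u ⁆ , u , q⊆p∪q ⁅ b ⁆ ⁅ u ⁆ (x∈⁅x⁆ u) , u≢b ∘ x∈⁅y⁆⇒x≡y b))
    where open PointedAt pt

  two≤height : PointedAt Λ b → 1 < ∣ Λ ∣ → HeightAtMost Λ n → 2 ≤ n
  two≤height pt 1<∣Λ∣ ≤n with D , chainD , 2≤ ← two-chain pt 1<∣Λ∣ = ≤-trans 2≤ (≤n D chainD)

  ≽-pointed : PointedAt Λ b → v ∈ Λ → PointedAt (Λ ≽[ v ]) v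
  ≽-pointed {Λ} pt v∈Λ = record
    { base∈  = ∈≽⁺ v∈Λ ≼-refl
    ; least  = proj₂ ∘ ∈≽⁻ {Λ = Λ}
    ; convex = λ v≼x x≼u u∈ → ∈≽⁺ (convex (≼-trans (least v∈Λ) v≼x) x≼u (proj₁ (∈≽⁻ u∈))) v≼x
    }
    where open PointedAt pt

  ⋡-pointed : PointedAt Λ b → v ∈ Λ → v ≢ b → PointedAt (Λ ⋡[ v ]) b
  ⋡-pointed {Λ} pt v∈Λ v≢b = record
    { base∈  = ∈⋡⁺ base∈ λ v≼b → v≢b (antisym v≼b (least v∈Λ))
    ; least  = least ∘ proj₁ ∘ ∈⋡⁻ {Λ = Λ}
    ; convex = λ b≼x x≼u u∈ → ∈⋡⁺ (convex b≼x x≼u (proj₁ (∈⋡⁻ u∈)))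
                                   λ v≼x → proj₂ (∈⋡⁻ {Λ = Λ} u∈) (≼-trans v≼x x≼u)
    }
    where open PointedAt pt

  singleton : PointedAt Λ b → ∣ Λ ∣ ≤ 1 → Λ ≡ ⁅ b ⁆
  singleton {Λ} {b} pt ∣Λ∣≤1 = ⊆-antisym
    (λ {x} x∈Λ → decidable-stable (x ∈? ⁅ b ⁆) λ x∉ → contradiction ∣Λ∣≤1
       (<⇒≱ (subst (_< ∣ Λ ∣) (∣⁅x⁆∣≡1 b) (p⊂q⇒∣p∣<∣q∣ (⁅b⁆⊆Λ , x , x∈Λ , x∉)))))
    ⁅b⁆⊆Λ
    where
    ⁅b⁆⊆Λ : ⁅ b ⁆ ⊆ Λ
    ⁅b⁆⊆Λ x∈ = subst (_∈ Λ) (sym (x∈⁅y⁆⇒x≡y b x∈)) (PointedAt.base∈ pt)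

-- Runs of the strategy

module Strategy (P : FinPoset) where

  open FinPoset P
  open Order P
  open IsDecPartialOrder isDecPartialOrder
    using (antisym) renaming (refl to ≼-refl; reflexive to ≼-reflexive; trans to ≼-trans)

  -- `Admissible` for posets with more than one node: there k = 1 leaves only queries of full
  -- height, and the two rules for k ≥ 2 merge, with the query height in floor form.
  data Query (Λ : Nodes) : ℕ → Node → Set where
    last  : ∀ {n v} → HasHeight Λ n → HasNodeHeight Λ v n → Query Λ 1 v
    inner : ∀ {e n h v} → HasHeight Λ n → OnMaximalChain Λ v → HasNodeHeight Λ v h →
            (n ≤ 2 + e × h ≡ 2) ⊎ (2 + e < n × h ≡ suc (n / (2 + e))) → Query Λ (2 + e) v

  toQuery : ∀ {Λ k b v} → PointedAt Λ b → 1 ≤ k → 1 < ∣ Λ ∣ → Admissible Λ k v → Query Λ k v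
  toQuery pt _ 1<∣Λ∣ (k≡1 hasHeight nodeHeight) = last hasHeight nodeHeight
  toQuery {k = suc zero} pt _ 1<∣Λ∣ (k≥n hasHeight n≤1 _ _) =
    contradiction n≤1 (<⇒≱ (two≤height pt 1<∣Λ∣ (height-atMost hasHeight)))
  toQuery {k = suc (suc e)} pt _ 1<∣Λ∣ (k≥n hasHeight n≤k onMax nodeHeight) =
    inner hasHeight onMax nodeHeight (inj₁ (n≤k , refl))
  toQuery {k = suc zero} pt _ 1<∣Λ∣ (1<k<n _ (s≤s ()) _ _ _)
  toQuery {k = suc (suc e)} pt _ 1<∣Λ∣ (1<k<n {n = n} hasHeight _ k<n onMax nodeHeight) =
    inner hasHeight onMax nodeHeight (inj₂ (k<n , ⌈1+n/k⌉≡1+n/k n (suc e)))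

  admissible : ∀ {Λ k b n} → PointedAt Λ b → 1 ≤ k → 1 < ∣ Λ ∣ → HasHeight Λ n →
               ∃[ v ] Admissible Λ k v
  admissible {k = suc zero} pt _ 1<∣Λ∣ hasHeight
    with v , _ , nodeHeight ← node-at-height pt hasHeight
           (<⇒≤ (two≤height pt 1<∣Λ∣ (height-atMost hasHeight))) ≤-refl
    = v , k≡1 hasHeight nodeHeight
  admissible {k = suc (suc e)} {n = n} pt _ 1<∣Λ∣ hasHeight with n ≤? 2 + e
  ... | yes n≤k
    with v , onMax , nodeHeight ← node-at-height pt hasHeight z<s
           (two≤height pt 1<∣Λ∣ (height-atMost hasHeight))
    = v , k≥n hasHeight n≤k onMax nodeHeight
  ... | no n≰k
    with v , onMax , nodeHeight ← node-at-height {h = ⌈ n + 1 / 2 + e ⌉} pt hasHeight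
           (subst (1 ≤_) (sym (⌈1+n/k⌉≡1+n/k n (suc e))) z<s)
           (subst (_≤ n) (sym (⌈1+n/k⌉≡1+n/k n (suc e)))
             (m/n<m n (2 + e) {{>-nonZero (≤-<-trans z≤n (≰⇒> n≰k))}} (s≤s z<s)))
    = v , 1<k<n hasHeight (s≤s z<s) (≰⇒> n≰k) onMax nodeHeight

  query-height : ∀ {Λ k b v} → PointedAt Λ b → 1 < ∣ Λ ∣ → Query Λ k v →
                 ∃[ h ] HasNodeHeight Λ v h × 2 ≤ h
  query-height pt 1<∣Λ∣ (last hasHeight nodeHeight) =
    _ , nodeHeight , two≤height pt 1<∣Λ∣ (height-atMost hasHeight)
  query-height pt 1<∣Λ∣ (inner _ _ nodeHeight (inj₁ (_ , refl))) = _ , nodeHeight , ≤-refl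
  query-height pt 1<∣Λ∣ (inner {e} _ _ nodeHeight (inj₂ (k<n , refl))) =
    _ , nodeHeight , s≤s (m≥n⇒m/n>0 (<⇒≤ k<n))

  -- The total budgets `p⁺` and `q⁺` stay fixed, so inductions only check that the counts so far
  -- plus the remaining cost fit into them.
  module Run (μ : Nodes) (p⁺ q⁺ : ℕ) where

    -- The invariant behind correctness. It follows the top of μ, since μ is an ideal of the
    -- original poset and need not be contained in Λ.
    Located : Nodes → Set
    Located Λ = μ ≡ ∅ ⊎ (∃[ m ] m ∈ Λ × μ ≡ ↓ m)

    record Good (s : State) : Set where
      field
        terminates : Acc (flip (Round μ)) s
        bounded    : ∀ {t} → Star (Round μ) s t → positives t ≤ p⁺ × queries t ≤ q⁺
        correct    : ∀ {t} → Star (Round μ) s t → IsNormalForm (Round μ) t → Answers t μ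

    open Good

    good : ∀ {s} → positives s ≤ p⁺ → queries s ≤ q⁺ →
           (IsNormalForm (Round μ) s → Answers s μ) →
           (∀ {t} → Round μ s t → Good t) → Good s
    good p≤ q≤ answers next .terminates = acc λ r → next r .terminates
    good p≤ q≤ answers next .bounded ε = p≤ , q≤
    good p≤ q≤ answers next .bounded (r ◅ rs) = next r .bounded rs
    good p≤ q≤ answers next .correct ε = answers
    good p≤ q≤ answers next .correct (r ◅ rs) = next r .correct rs

    -- Once the height has dropped, the induction hypothesis concerns the current state while a
    -- successor is asked for; this bridges the two.
    good-next : ∀ {s t} → Good s → Round μ s t → Good t
    good-next g r .terminates with acc rec ← g .terminates = rec r
    good-next g r .bounded rs = g .bounded (r ◅ rs)
    good-next g r .correct rs = g .correct (r ◅ rs)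

    good-done : ∀ {a p q} → p ≤ p⁺ → q ≤ q⁺ → a ≡ μ → Good (done a p q)
    good-done p≤ q≤ a≡μ = good p≤ q≤ (λ _ → a≡μ) λ ()

    located-∈ : ∀ {Λ v} → Located Λ → v ∈ μ → ∃[ m ] m ∈ Λ × μ ≡ ↓ m × v ≼ m
    located-∈ (inj₁ refl)             v∈μ = contradiction v∈μ ∉⊥
    located-∈ (inj₂ (m , m∈Λ , refl)) v∈μ = m , m∈Λ , refl , ∈↓⁻ v∈μ

    located-≽ : ∀ {Λ v} → Located Λ → v ∈ μ → Located (Λ ≽[ v ])
    located-≽ loc v∈μ with m , m∈Λ , μ≡ , v≼m ← located-∈ loc v∈μ = inj₂ (m , ∈≽⁺ m∈Λ v≼m , μ≡)

    located-⋡ : ∀ {Λ v} → Located Λ → v ∉ μ → Located (Λ ⋡[ v ])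
    located-⋡ (inj₁ μ≡)               v∉μ = inj₁ μ≡
    located-⋡ (inj₂ (m , m∈Λ , refl)) v∉μ = inj₂ (m , ∈⋡⁺ m∈Λ (v∉μ ∘ ∈↓⁺) , refl)

    located-⁅⁆-∈ : ∀ {v} → Located ⁅ v ⁆ → v ∈ μ → ↓ v ≡ μ
    located-⁅⁆-∈ {v} loc v∈μ with m , m∈ , refl , _ ← located-∈ loc v∈μ =
      cong ↓_ (sym (x∈⁅y⁆⇒x≡y v m∈))

    located-⁅⁆-∉ : ∀ {v} → Located ⁅ v ⁆ → v ∉ μ → ∅ ≡ μ
    located-⁅⁆-∉ (inj₁ refl) v∉μ = refl
    located-⁅⁆-∉ {v} (inj₂ (m , m∈ , refl)) v∉μ =
      contradiction (∈↓⁺ (≼-reflexive (sym (x∈⁅y⁆⇒x≡y v m∈)))) v∉μ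

    good-singleton : ∀ {Λ b k p q} → PointedAt Λ b → Located Λ → ∣ Λ ∣ ≤ 1 →
                     suc p ≤ p⁺ → suc q ≤ q⁺ → Good (running Λ k p q)
    good-singleton {Λ} {b} {k} {p} {q} pt loc ∣Λ∣≤1 p< q< = good (<⇒≤ p<) (<⇒≤ q<) stuck next
      where
      stuck : ¬ IsNormalForm (Round μ) (running Λ k p q)
      stuck nf with b ∈? μ
      ... | yes b∈μ = nf (_ , singleton-yes (singleton pt ∣Λ∣≤1) b∈μ)
      ... | no  b∉μ = nf (_ , singleton-no (singleton pt ∣Λ∣≤1) b∉μ)
      next : ∀ {t} → Round μ (running Λ k p q) t → Good t
      next (empty refl)              = contradiction (PointedAt.base∈ pt) ∉⊥
      next (singleton-yes refl v∈μ)  = good-done p< q< (located-⁅⁆-∈ loc v∈μ)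
      next (singleton-no refl v∉μ)   = good-done (<⇒≤ p<) q< (located-⁅⁆-∉ loc v∉μ)
      next (yes-stop 1< _ _ _)       = contradiction ∣Λ∣≤1 (<⇒≱ 1<)
      next (yes-continue 1< _ _ _)   = contradiction ∣Λ∣≤1 (<⇒≱ 1<)
      next (no-continue 1< _ _)      = contradiction ∣Λ∣≤1 (<⇒≱ 1<)

    -- Isolates what is independent of counting: invariants, answers given on stopping, and
    -- progress. The `Round` step is passed on so that `good-next` can be applied to it.
    good-running : ∀ {Λ b k p q} → PointedAt Λ b → Located Λ → 1 < ∣ Λ ∣ → 1 ≤ k →
      p + k ≤ p⁺ → suc q ≤ q⁺ →
      (∀ {v} → Query Λ k v → PointedAt (Λ ≽[ v ]) v → Located (Λ ≽[ v ]) →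
         ∣ Λ ≽[ v ] ∣ ≢ 1 → Round μ (running Λ k p q) (running (Λ ≽[ v ]) (k ∸ 1) (suc p) (suc q)) →
         Good (running (Λ ≽[ v ]) (k ∸ 1) (suc p) (suc q))) →
      (∀ {v} → Query Λ k v → v ∈ Λ → PointedAt (Λ ⋡[ v ]) b → Located (Λ ⋡[ v ]) →
         Round μ (running Λ k p q) (running (Λ ⋡[ v ]) k p (suc q)) →
         Good (running (Λ ⋡[ v ]) k p (suc q))) →
      Good (running Λ k p q)
    good-running {Λ} {b} {k} {p} {q} pt loc 1<∣Λ∣ 1≤k p+k≤ q< positive negative =
      good (≤-trans (m≤m+n p k) p+k≤) (<⇒≤ q<)
        (λ nf → ¬¬-hasHeight λ { (n , hasHeight) → stuck nf (admissible pt 1≤k 1<∣Λ∣ hasHeight) })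
        next
      where
      p< : suc p ≤ p⁺
      p< = ≤-trans (≤-trans (≤-reflexive (+-comm 1 p)) (+-monoʳ-≤ p 1≤k)) p+k≤
      stuck : IsNormalForm (Round μ) (running Λ k p q) → ¬ (∃[ v ] Admissible Λ k v)
      stuck nf (v , adm) with v ∈? μ
      ... | no v∉μ = nf (_ , no-continue 1<∣Λ∣ adm v∉μ)
      ... | yes v∈μ with ∣ Λ ≽[ v ] ∣ ≟ 1
      ...   | yes ≡1 = nf (_ , yes-stop 1<∣Λ∣ adm v∈μ ≡1)
      ...   | no  ≢1 = nf (_ , yes-continue 1<∣Λ∣ adm v∈μ ≢1)
      next : ∀ {t} → Round μ (running Λ k p q) t → Good t
      next (empty refl) = contradiction (PointedAt.base∈ pt) ∉⊥
      next (singleton-yes {v = v} refl _) = contradiction (∣⁅x⁆∣≡1 v) (>⇒≢ 1<∣Λ∣)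
      next (singleton-no {v = v} refl _)  = contradiction (∣⁅x⁆∣≡1 v) (>⇒≢ 1<∣Λ∣)
      next (yes-stop {v = v} _ adm v∈μ ≡1)
        with _ , nodeHeight , _ ← query-height pt 1<∣Λ∣ (toQuery pt 1≤k 1<∣Λ∣ adm)
        = good-done p< q< (located-⁅⁆-∈ (subst Located
            (singleton (≽-pointed pt (nodeHeight-∈ nodeHeight)) (≤-reflexive ≡1)) (located-≽ loc v∈μ)) v∈μ)
      next r@(yes-continue _ adm v∈μ ≢1) with query ← toQuery pt 1≤k 1<∣Λ∣ adm
        with _ , nodeHeight , _ ← query-height pt 1<∣Λ∣ query
        = positive query (≽-pointed pt (nodeHeight-∈ nodeHeight)) (located-≽ loc v∈μ) ≢1 r
      next r@(no-continue _ adm v∉μ) with query ← toQuery pt 1≤k 1<∣Λ∣ adm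
        with _ , nodeHeight , 2≤h ← query-height pt 1<∣Λ∣ query
        with v∈Λ ← nodeHeight-∈ nodeHeight
        = negative query v∈Λ (⋡-pointed pt v∈Λ (nodeHeight-≢base pt nodeHeight 2≤h))
            (located-⋡ loc v∉μ) r

    -- Counting the queries

    prune : ∀ {Λ v u xs} → u ∈ˡ xs → v ≼ u →
            length (filter (_∈? (Λ ⋡[ v ])) xs) < length xs
    prune {Λ} {v} {xs = xs} u∈xs v≼u =
      filter-notAll (_∈? (Λ ⋡[ v ])) xs (lose u∈xs λ u∈ → proj₂ (∈⋡⁻ {Λ = Λ} u∈) v≼u)

    ⋡-height : ∀ {Λ v n} → HeightAtMost Λ n → HeightAtMost (Λ ⋡[ v ]) n
    ⋡-height {Λ} ≤n D (D⊆ , chain) = ≤n D (proj₁ ∘ ∈⋡⁻ {Λ = Λ} ∘ D⊆ , chain)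

    -- The queried node itself leaves the list xs of candidates.
    good-k≡1 : ∀ B {Λ b n p q xs} → PointedAt Λ b → Located Λ → HeightAtMost Λ n → 1 ≤ n →
      (∀ {i u} → i < n → u ∈ Λ → u ∈ˡ level i b → u ∈ˡ xs) → length xs ≤ B →
      p + 1 ≤ p⁺ → q + B ≤ q⁺ → Good (running Λ 1 p q)
    good-k≡1 zero pt loc ≤n 1≤n candidates xs≤B p+1≤ q+B≤ =
      contradiction (∈⇒1≤length (candidates 1≤n (PointedAt.base∈ pt) (here refl))) (<⇒≱ (s≤s xs≤B))
    good-k≡1 (suc B) {Λ} {b} {n} {p} {q} {xs} pt loc ≤n 1≤n candidates xs≤B p+1≤ q+B≤
      with ∣ Λ ∣ ≤? 1
    ... | yes ∣Λ∣≤1 = good-singleton pt loc ∣Λ∣≤1 (subst (_≤ p⁺) (+-comm p 1) p+1≤)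
                        (≤-trans (s≤s (m≤m+n q B)) q+1+B≤)
      where q+1+B≤ = subst (_≤ q⁺) (+-suc q B) q+B≤
    ... | no ∣Λ∣≰1 = good-running pt loc (≰⇒> ∣Λ∣≰1) ≤-refl p+1≤
                        (≤-trans (s≤s (m≤m+n q B)) q+1+B≤) positive negative
      where
      q+1+B≤ = subst (_≤ q⁺) (+-suc q B) q+B≤
      positive : ∀ {v} → Query Λ 1 v → PointedAt (Λ ≽[ v ]) v → Located (Λ ≽[ v ]) →
                 ∣ Λ ≽[ v ] ∣ ≢ 1 → Round μ (running Λ 1 p q) (running (Λ ≽[ v ]) 0 (suc p) (suc q)) →
                 Good (running (Λ ≽[ v ]) 0 (suc p) (suc q))
      -- Nothing lies above a node of full height, so a positive answer leaves a single node and the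
      -- run stops instead of continuing.
      positive {v} (last {m} hasHeight nodeHeight) pt′ _ ≢1 _ = contradiction
        (≤-antisym ∣≽v∣≤1 (subst (_≤ ∣ Λ ≽[ v ] ∣) (∣⁅x⁆∣≡1 v) (p⊆q⇒∣p∣≤∣q∣
          λ x∈ → subst (_∈ Λ ≽[ v ]) (sym (x∈⁅y⁆⇒x≡y v x∈)) (PointedAt.base∈ pt′)))) ≢1
        where
        ∣≽v∣≤1 : ∣ Λ ≽[ v ] ∣ ≤ 1
        ∣≽v∣≤1 = ≮⇒≥ λ 1< → contradiction
          (two≤height pt′ 1< (≽-height {m = 1} nodeHeight (height-atMost hasHeight) ≤-refl)) λ { (s≤s ()) }
      negative : ∀ {v} → Query Λ 1 v → v ∈ Λ → PointedAt (Λ ⋡[ v ]) b → Located (Λ ⋡[ v ]) →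
                 Round μ (running Λ 1 p q) (running (Λ ⋡[ v ]) 1 p (suc q)) →
                 Good (running (Λ ⋡[ v ]) 1 p (suc q))
      negative {v} (last hasHeight nodeHeight) v∈Λ pt′ loc′ _
        with i , i<m , v∈level ← level-top pt hasHeight nodeHeight
        = good-k≡1 B pt′ loc′ (⋡-height ≤n) 1≤n
            (λ i<n u∈ u∈level → ∈-filter⁺ (_∈? (Λ ⋡[ v ])) (candidates i<n (proj₁ (∈⋡⁻ u∈)) u∈level) u∈)
            (s≤s⁻¹ (≤-trans (prune (candidates (≤-trans i<m (height-≤ hasHeight ≤n)) v∈Λ v∈level) ≼-refl) xs≤B))
            p+1≤ q+1+B≤

    -- The height enters only as an upper bound, so deleting nodes preserves the hypothesis.
    Bounded : ℕ → ℕ → Set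
    Bounded e n = ∀ {Λ b p q} → 1 ≤ n → PointedAt Λ b → Located Λ → HeightAtMost Λ n →
      p + suc e ≤ p⁺ → q + f (suc e) degree n ≤ q⁺ → Good (running Λ (suc e) p q)

    -- Every negative query removes one of the candidates xs for a node of height
    -- w + 1 above it; once none is left the height has dropped to w.
    good-k≥2 : ∀ {e n w} B → Split e degree n w → Bounded e (n ∸ w) → Bounded (suc e) w →
      ∀ {Λ b p q xs} → PointedAt Λ b → Located Λ → HeightAtMost Λ n →
      (∀ {u} → u ∈ Λ → u ∈ˡ level w b → u ∈ˡ xs) → length xs ≤ B →
      p + (2 + e) ≤ p⁺ → q + (B + f (suc e) degree (n ∸ w)) ≤ q⁺ → Good (running Λ (2 + e) p q)
    good-k≥2 {e} {n} {w} B sp boundedˡ boundedʷ {Λ} {b} {p} {q} {xs} pt loc ≤n candidates xs≤B p+k≤ q+B≤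
      with ∣ Λ ∣ ≤? 1
    ... | yes ∣Λ∣≤1 = good-singleton pt loc ∣Λ∣≤1 (≤-trans (m≤n+m (suc p) (suc e))
                        (≤-trans (≤-reflexive (arith e p)) p+k≤)) q<
      where
      open Split sp
      arith : ∀ e p → suc e + suc p ≡ p + (2 + e)
      arith = solve-∀
      q< : suc q ≤ q⁺
      q< = ≤-trans (≤-reflexive (+-comm 1 q)) (≤-trans (+-monoʳ-≤ q (≤-trans
             (f-positive e degree (m<n⇒0<n∸m q<n)) (m≤n+m _ B))) q+B≤)
    ... | no ∣Λ∣≰1 = good-running pt loc 1<∣Λ∣ z<s p+k≤ q< positive negative
      where
      open Split sp
      1<∣Λ∣ = ≰⇒> ∣Λ∣≰1
      F = f (suc e) degree (n ∸ w)
      p+1+k≤ : suc p + suc e ≤ p⁺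
      p+1+k≤ = subst (_≤ p⁺) (+-suc p (suc e)) p+k≤
      q< : suc q ≤ q⁺
      q< = ≤-trans (≤-reflexive (+-comm 1 q)) (≤-trans (+-monoʳ-≤ q (≤-trans
             (f-positive e degree (m<n⇒0<n∸m q<n)) (m≤n+m _ B))) q+B≤)

      -- Two nodes force 2 ≤ m ≤ w, which is the hypothesis of `f-large`.
      low-height : ∀ {m} → HasHeight Λ m → m ≤ w → Good (running Λ (2 + e) p q)
      low-height hasHeight m≤w = boundedʷ 1≤q pt loc
        (λ D chainD → ≤-trans (height-atMost hasHeight D chainD) m≤w) p+k≤
        (≤-trans (+-monoʳ-≤ q (≤-trans (f-large (≤-trans
          (two≤height pt 1<∣Λ∣ (height-atMost hasHeight)) m≤w)) (m≤n+m F B))) q+B≤)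

      query-≤ : ∀ {m h} → m ≤ n → (m ≤ 2 + e × h ≡ 2) ⊎ (2 + e < m × h ≡ suc (m / (2 + e))) →
                h ≤ suc w × suc m ≤ n ∸ w + h
      query-≤ {m} m≤n (inj₁ (m≤k , refl)) = s≤s 1≤q , (begin
        suc m             ≤⟨ m+n≤o⇒m≤o∸n (suc m) (s≤s (low m≤n m≤k)) ⟩
        2 + n ∸ w         ≡⟨ +-∸-assoc 2 (<⇒≤ q<n) ⟩
        2 + (n ∸ w)       ≡⟨ +-comm 2 (n ∸ w) ⟩
        n ∸ w + 2         ∎)
        where open ≤-Reasoning
      query-≤ {m} m≤n (inj₂ (k<m , refl)) with m/k≤w , m+w≤ ← high m≤n k<m = s≤s m/k≤w , (begin
        suc m                       ≤⟨ s≤s (m+n≤o⇒m≤o∸n m m+w≤) ⟩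
        suc (n + m / (2 + e) ∸ w)   ≡⟨ cong suc (+-∸-comm (m / (2 + e)) (<⇒≤ q<n)) ⟩
        suc (n ∸ w + m / (2 + e))   ≡⟨ +-suc (n ∸ w) (m / (2 + e)) ⟨
        n ∸ w + suc (m / (2 + e))   ∎)
        where open ≤-Reasoning

      candidate : ∀ {v m h} → HasHeight Λ m → ¬ m ≤ w → OnMaximalChain Λ v → HasNodeHeight Λ v h →
                  h ≤ suc w → ∃[ u ] u ∈ˡ xs × v ≼ u
      candidate hasHeight m≰w onMax nodeHeight h≤
        with u , u∈Λ , u∈level , v≼u ← level-above pt hasHeight (≰⇒> m≰w) onMax nodeHeight h≤
        = u , candidates u∈Λ u∈level , v≼u

      positive : ∀ {v} → Query Λ (2 + e) v → PointedAt (Λ ≽[ v ]) v → Located (Λ ≽[ v ]) →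
                 ∣ Λ ≽[ v ] ∣ ≢ 1 → Round μ (running Λ (2 + e) p q) (running (Λ ≽[ v ]) (suc e) (suc p) (suc q)) →
                 Good (running (Λ ≽[ v ]) (suc e) (suc p) (suc q))
      positive (inner {n = m} hasHeight onMax nodeHeight h≡) pt′ loc′ _ r with m ≤? w
      ... | yes m≤w = good-next (low-height hasHeight m≤w) r
      ... | no  m≰w
        with h≤ , m<n∸w+h ← query-≤ (height-≤ hasHeight ≤n) h≡
        -- The candidate shows B ≥ 1, and that unit pays for the present query.
        with u , u∈xs , _ ← candidate hasHeight m≰w onMax nodeHeight h≤
        = boundedˡ (m<n⇒0<n∸m q<n) pt′ loc′ (≽-height nodeHeight (height-atMost hasHeight) m<n∸w+h) p+1+k≤
            (≤-trans (≤-reflexive (sym (+-suc q F)))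
              (≤-trans (+-monoʳ-≤ q (+-monoˡ-≤ F (≤-trans (∈⇒1≤length u∈xs) xs≤B))) q+B≤))

      negative : ∀ {v} → Query Λ (2 + e) v → v ∈ Λ → PointedAt (Λ ⋡[ v ]) b → Located (Λ ⋡[ v ]) →
                 Round μ (running Λ (2 + e) p q) (running (Λ ⋡[ v ]) (2 + e) p (suc q)) →
                 Good (running (Λ ⋡[ v ]) (2 + e) p (suc q))
      negative {v} (inner {n = m} hasHeight onMax nodeHeight h≡) v∈Λ pt′ loc′ r with m ≤? w
      ... | yes m≤w = good-next (low-height hasHeight m≤w) r
      ... | no  m≰w
        with h≤ , _ ← query-≤ (height-≤ hasHeight ≤n) h≡
        with u , u∈xs , v≼u ← candidate hasHeight m≰w onMax nodeHeight h≤
        = remove B (≤-trans (prune u∈xs v≼u) xs≤B) q+B≤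
        where
        -- B is split only here: it may be 0 once the height is at most w, whereas a remaining
        -- candidate makes it positive.
        remove : ∀ B → length (filter (_∈? (Λ ⋡[ v ])) xs) < B → q + (B + F) ≤ q⁺ →
                 Good (running (Λ ⋡[ v ]) (2 + e) p (suc q))
        remove (suc B) <B q+B≤ = good-k≥2 B sp boundedˡ boundedʷ pt′ loc′ (⋡-height ≤n)
          (λ u∈ u∈level → ∈-filter⁺ (_∈? (Λ ⋡[ v ])) (candidates (proj₁ (∈⋡⁻ u∈)) u∈level) u∈)
          (s≤s⁻¹ <B) p+k≤ (subst (_≤ q⁺) (+-suc q (B + F)) q+B≤)

    good-split : {{_ : NonZero degree}} → ∀ {e n} → (∀ m → Bounded e m) →
                 (∀ {m} → m < n → Bounded (suc e) m) → Bounded (suc e) n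
    good-split {e} {n} boundedˡ boundedʷ {Λ} {b} {p} {q} 1≤n pt loc ≤n p+k≤ q+f≤ with ∣ Λ ∣ ≤? 1
    ... | yes ∣Λ∣≤1 = good-singleton pt loc ∣Λ∣≤1
      (≤-trans (≤-trans (≤-reflexive (+-comm 1 p)) (+-monoʳ-≤ p z<s)) p+k≤)
      (≤-trans (≤-trans (≤-reflexive (+-comm 1 q)) (+-monoʳ-≤ q (f-positive (suc e) degree 1≤n))) q+f≤)
    ... | no ∣Λ∣≰1 with w , sp ← split e degree n (two≤height pt (≰⇒> ∣Λ∣≰1) ≤n) =
      good-k≥2 _ sp (boundedˡ (n ∸ w)) (boundedʷ (Split.q<n sp)) pt loc ≤n
        (λ _ u∈level → u∈level) (length-level w b)
        p+k≤ (≤-trans (+-monoʳ-≤ q (Split.f-split sp)) q+f≤)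

    -- Outer induction on the number of positive answers left, for all heights; inner well-founded
    -- induction on the height, for a drop without a positive answer.
    good-bounded : {{_ : NonZero degree}} → ∀ e n → Acc _<_ n → Bounded e n
    good-bounded zero n _ {b = b} {q = q} 1≤n pt loc ≤n p+1≤ q+f≤ =
      -- All nodes on the levels below n are candidates, and f 1 ℓ n is the sum of the bounds ℓ ^ i
      -- on these levels.
      good-k≡1 _ {xs = concatMap (λ i → level i b) (upTo n)} pt loc ≤n 1≤n
        (λ i<n _ u∈level → ∈-concatMap⁺ (λ i → level i b) (lose (∈-upTo⁺ i<n) u∈level))
        (length-concatMap-≤-sum (λ i → length-level i b) (upTo n)) p+1≤
        (subst (λ x → q + x ≤ q⁺) (f₁ degree n) q+f≤)
    good-bounded (suc e) n (acc rec) = good-split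
      (λ m → good-bounded e m (<-wellFounded m)) (λ m<n → good-bounded (suc e) _ (rec m<n))

  -- The initial state

  lower-bound : Pointed → ∀ a (xs : List Node) → ∃[ c ] c ≼ a × All (c ≼_) xs
  lower-bound pointed a []       = a , ≼-refl , []
  lower-bound pointed a (x ∷ xs)
    with c , c≼a , c≼xs ← lower-bound pointed a xs
    with d , d≼c , d≼x ← pointed c x
    = d , ≼-trans d≼c c≼a , d≼x ∷ All.map (≼-trans d≼c) c≼xs

  ⊤-pointed : Pointed → Node → ∃[ b ] PointedAt ⊤ b
  ⊤-pointed pointed a with b , _ , b≼ ← lower-bound pointed a (allFin size) = b , record
    { base∈  = ∈⊤
    ; least  = λ {u} _ → All.lookup b≼ (∈-allFin u)
    ; convex = λ _ _ _ → ∈⊤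
    }

  -- Height at least 2 puts a node on level 1, which would be empty for degree 0. Monotonicity of
  -- powers of ℓ in the exponent depends on this.
  degree-nonZero : ∀ {b n} → PointedAt ⊤ b → HasHeight ⊤ n → 2 ≤ n → NonZero degree
  degree-nonZero {b} pt (C , maxC , refl) 2≤n with degree in eq
  ... | suc _ = _
  ... | zero with u , _ , u∈level , _ ← maximal-level pt maxC 1 2≤n =
    contradiction (≤-trans (∈⇒1≤length u∈level) (length-level 1 b))
      (subst (λ d → ¬ 1 ≤ d * 1) (sym eq) λ ())

  ideal-located : ∀ {μ} → IsIdeal μ → Run.Located μ 0 0 ⊤
  ideal-located (inj₁ μ≡)       = inj₁ μ≡
  ideal-located (inj₂ (v , μ≡)) = inj₂ (v , ∈⊤ , μ≡)

  good-empty : ∀ {μ k q⁺} → ¬ Node → Run.Good μ k q⁺ (start k)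
  good-empty {μ} ∄node = good z≤n z≤n (λ nf → contradiction (_ , empty ⊤≡∅) nf) next
    where
    open Run μ _ _
    ⊤≡∅ : ⊤ ≡ ∅
    ⊤≡∅ = Empty-unique λ (v , _) → ∄node v
    next : ∀ {t} → Round μ (start _) t → Good t
    next (empty _) = good-done z≤n z≤n (sym (Empty-unique λ (v , _) → ∄node v))
    next (singleton-yes {v = v} _ _)    = contradiction v ∄node
    next (singleton-no {v = v} _ _)     = contradiction v ∄node
    next (yes-stop {v = v} _ _ _ _)     = contradiction v ∄node
    next (yes-continue {v = v} _ _ _ _) = contradiction v ∄node
    next (no-continue {v = v} _ _ _)    = contradiction v ∄node

  good-start : ∀ {μ n} e → Pointed → HasHeight ⊤ n → IsIdeal μ →
               Run.Good μ (suc e) (f (suc e) degree n) (start (suc e))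
  good-start {μ} {n} e pointed hasHeight ideal with nonempty? ⊤
  ... | no ∄node = good-empty λ v → ∄node (v , ∈⊤)
  ... | yes (v , _) with b , pt ← ⊤-pointed pointed v with ∣ ⊤ {size} ∣ ≤? 1
  -- A one-node poset has degree 0, outside the range of `good-bounded`; its single query is covered
  -- by 1 ≤ f.
  ...   | yes ∣⊤∣≤1 = good-singleton pt (ideal-located ideal) ∣⊤∣≤1 z<s (f-positive e degree 1≤n)
    where
    open Run μ (suc e) (f (suc e) degree n)
    1≤n : 1 ≤ n
    1≤n = subst (_≤ n) (∣⁅x⁆∣≡1 v) (height-atMost hasHeight ⁅ v ⁆ (chain-⁅⁆ ∈⊤))
  ...   | no ∣⊤∣≰1 = good-bounded {{degree-nonZero pt hasHeight 2≤n}} e n (<-wellFounded n)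
      (<⇒≤ 2≤n) pt (ideal-located ideal) (height-atMost hasHeight) ≤-refl ≤-refl
    where
    open Run μ (suc e) (f (suc e) degree n)
    2≤n = two≤height pt (≰⇒> ∣⊤∣≰1) (height-atMost hasHeight)

theoremA : (k : ℕ) .{{_ : NonZero k}} (P : FinPoset) → let open FinPoset P in
    Pointed → (ℓ n : ℕ) → degree ≡ ℓ → HasHeight ⊤ n →
    (∀ μ → IsIdeal μ →
       Identifies μ k
       × (∀ {s} → Reachable μ k s → positives s ≤ k × queries s ≤ f k ℓ n))
    × (ℓ ≡ 1 → f k ℓ n ≤ ⌈ n / k ⌉ + k ∸ 1)
    × (1 < ℓ → f k ℓ n ≤ k * ℓ ^ ⌈ n / k ⌉)
theoremA (suc e) P pointed ℓ n refl hasHeight =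
  identification ,
  (λ ℓ≡1 → subst (λ ℓ → f (suc e) ℓ n ≤ ⌈ n / suc e ⌉ + suc e ∸ 1) (sym ℓ≡1) (f-bound-1 e n)) ,
  f-bound->1 e ℓ n
  where
  open FinPoset P
  open Strategy P
  identification : ∀ μ → IsIdeal μ → Identifies μ (suc e)
    × (∀ {s} → Reachable μ (suc e) s → positives s ≤ suc e × queries s ≤ f (suc e) ℓ n)
  identification μ ideal = (terminates , correct) , bounded
    where
    open Run μ (suc e) (f (suc e) ℓ n)
    open Good (good-start e pointed hasHeight ideal)
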